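{- Let $p$ be a prime satisfying $\phi(p-1) \leq (p-1)/4$, where $\phi$ is Euler's totient function. Then there exist two consecutive integers $n, n+1$ (with $1 \le n$ and $n+1 \le p-1$) such that each of $n$ and $n+1$ is a quadratic non-residue modulo $p$ and neither $n$ nor $n+1$ is a primitive root modulo $p$.
   Context: An integer $a$ coprime to $p$ is a quadratic non-residue modulo $p$ if $x^2 \equiv a \pmod p$ has no solution; it is a primitive root modulo $p$ if its multiplicative order modulo $p$ is $p-1$. A quadratic non-residue that is not a primitive root is called a QNRNP; the theorem asserts that such $p$ has two consecutive QNRNPs. -}

module Defs where

open import Data.Nat using (ℕ; zero; suc; _+_; _*_; _∸_; _^_; _≤_; _<_; NonZero)
open import Data.Nat.DivMod using (_%_)
open import Data.Nat.GCD using (gcd)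
open import Data.Nat.Coprimality using (Coprime)
open import Data.Nat.Properties using (_≟_)
open import Data.List using (List; length; filter; upTo; map)
open import Data.Product using (∃; _×_)
open import Relation.Nullary using (¬_)
open import Relation.Binary.PropositionalEquality using (_≡_)

φ : ℕ → ℕ
φ m = length (filter (λ k → gcd k m ≟ 1) (map suc (upTo m)))

_≡_[mod_] : ℕ → ℕ → (n : ℕ) → .{{NonZero n}} → Set
a ≡ b [mod n ] = a % n ≡ b % n

QuadraticNonResidue : (p : ℕ) → .{{NonZero p}} → ℕ → Set
QuadraticNonResidue p a = Coprime a p × (¬ ∃ λ x → (x * x) ≡ a [mod p ])

HasOrder : (p : ℕ) → .{{NonZero p}} → ℕ → ℕ → Set
HasOrder p a m = 0 < m × (a ^ m) ≡ 1 [mod p ] ×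
                 (∀ k → 0 < k → k < m → ¬ ((a ^ k) ≡ 1 [mod p ]))

PrimitiveRoot : (p : ℕ) → .{{NonZero p}} → ℕ → Set
PrimitiveRoot p a = Coprime a p × HasOrder p a (p ∸ 1)

{-# OPTIONS --safe #-}
module Submission where

open import Defs
open import Data.Nat
open import Data.Nat.Combinatorics using (_C_; k![n∸k]!∣n!; nCk+nC[k+1]≡[n+1]C[k+1]; nCn≡1)
open import Data.Nat.Combinatorics.Specification using (nCk≡n!/k![n-k]!; k>n⇒nCk≡0)
open import Data.Nat.Coprimality using (Coprime)
open import Data.Nat.Divisibility
open import Data.Nat.DivMod
open import Data.Nat.GCD using (gcd; gcd[m,n]∣m; gcd[m,n]∣n; gcd[m,n]≢0)
open import Data.Nat.ListAction using (sum; product)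
open import Data.Nat.Primality
open import Data.Nat.Primality.Factorisation using (factorise; PrimeFactorisation)
open import Data.Nat.Properties
open import Data.Nat.Tactic.RingSolver using (solve-∀)
open import Data.Empty using (⊥-elim)
open import Data.List using (List; []; _∷_; map; filter; length; upTo; applyUpTo)
open import Data.List.Properties using (map-applyUpTo)
open import Data.List.Membership.Propositional using (_∈_)
open import Data.List.Membership.Propositional.Properties using (∈-filter⁺; ∈-upTo⁺)
open import Data.List.Membership.DecPropositional _≟_ using (_∈?_)
open import Data.List.Relation.Unary.All as All using (All; []; _∷_)
open import Data.List.Relation.Unary.All.Properties using (all-filter)
open import Data.List.Relation.Unary.AllPairs using (AllPairs; []; _∷_)
import Data.List.Relation.Unary.AllPairs.Properties as AllPairs
open import Data.List.Relation.Unary.Any using (here; there)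
open import Data.Product using (∃; _×_; _,_)
open import Data.Sum using (_⊎_; inj₁; inj₂)
open import Data.Vec using (Vec; []; _∷_; replicate)
open import Function using (_∘_; id)
open import Relation.Nullary using (Dec; yes; no; ¬_)
open import Relation.Nullary.Decidable using (_×-dec_; _⊎-dec_; True; toWitness)
open import Relation.Binary.PropositionalEquality

-- Let q ≥ 3 be an odd divisor of p − 1 and write p − 1 = 2qk.  Every solution a of aᵏ = −1 in 𝔽ₚ is a
-- non-residue (a^((p−1)/2) = (−1)^q = −1) of order at most 2k < p − 1, so it suffices to find two
-- consecutive elements of A = {a : aᵏ = −1}.  Let H = {h : hᵏ = 1}; both sets have k elements.  If A
-- had no consecutive pair, no line y = tx + c with t, c ∈ H would meet A × A (divide by c).  The
-- variance over all lines of the number of incidences with A × A is too small for k² empty lines: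
-- this gives k⁴ + p²k ≤ p³, which is impossible once k > (2q)³ − (2q)².
--
-- It remains to find q.  Counting the odd residues only, φ(p − 1) ≤ (p − 1)/4 forces the reciprocals
-- of the odd prime divisors of p − 1 to add up to at least 1/2.  If 3 does not divide p − 1, there are
-- then at least five such primes, or four starting with 5, and their least element is small enough.
-- If 3 divides p − 1, q = 3 works for k > 180, which leaves seven primes p < 1081 to be checked.

-- Indicator functions and finite sums.

𝟙 : ∀ {a} {P : Set a} → Dec P → ℕ
𝟙 (yes _) = 1
𝟙 (no _) = 0

𝟙-yes : ∀ {a} {P : Set a} (d : Dec P) → P → 𝟙 d ≡ 1
𝟙-yes (yes _) _ = refl
𝟙-yes (no ¬p) p = ⊥-elim (¬p p)

𝟙-no : ∀ {a} {P : Set a} (d : Dec P) → ¬ P → 𝟙 d ≡ 0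
𝟙-no (yes p) ¬p = ⊥-elim (¬p p)
𝟙-no (no _) _ = refl

𝟙-mono : ∀ {a b} {P : Set a} {Q : Set b} (d : Dec P) (e : Dec Q) → (P → Q) → 𝟙 d ≤ 𝟙 e
𝟙-mono (yes p) e f = ≤-reflexive (sym (𝟙-yes e (f p)))
𝟙-mono (no _) e f = z≤n

𝟙-idem : ∀ {a} {P : Set a} (d : Dec P) → 𝟙 d * 𝟙 d ≡ 𝟙 d
𝟙-idem (yes _) = refl
𝟙-idem (no _) = refl

𝟙≤1 : ∀ {a} {P : Set a} (d : Dec P) → 𝟙 d ≤ 1
𝟙≤1 (yes _) = ≤-refl
𝟙≤1 (no _) = z≤n

𝟙>0 : ∀ {a} {P : Set a} (d : Dec P) → 0 < 𝟙 d → P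
𝟙>0 (yes p) _ = p

∑ : ℕ → (ℕ → ℕ) → ℕ
∑ zero f = 0
∑ (suc n) f = ∑ n f + f n

infixr 8 ∑
syntax ∑ n (λ i → e) = ∑[ i < n ] e

∑-cong : ∀ n {f g : ℕ → ℕ} → (∀ i → i < n → f i ≡ g i) → ∑ n f ≡ ∑ n g
∑-cong zero h = refl
∑-cong (suc n) h = cong₂ _+_ (∑-cong n (λ i i<n → h i (m<n⇒m<1+n i<n))) (h n ≤-refl)

∑-mono : ∀ n {f g : ℕ → ℕ} → (∀ i → i < n → f i ≤ g i) → ∑ n f ≤ ∑ n g
∑-mono zero h = z≤n
∑-mono (suc n) h = +-mono-≤ (∑-mono n (λ i i<n → h i (m<n⇒m<1+n i<n))) (h n ≤-refl)

∑-distrib-+ : ∀ n (f g : ℕ → ℕ) → ∑[ i < n ] (f i + g i) ≡ ∑ n f + ∑ n g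
∑-distrib-+ zero f g = refl
∑-distrib-+ (suc n) f g rewrite ∑-distrib-+ n f g = interchange (∑ n f) (∑ n g) (f n) (g n)
  where
  interchange : ∀ a b c d → a + b + (c + d) ≡ a + c + (b + d)
  interchange = solve-∀

*-distribˡ-∑ : ∀ n c (f : ℕ → ℕ) → c * ∑ n f ≡ ∑[ i < n ] (c * f i)
*-distribˡ-∑ zero c f = *-zeroʳ c
*-distribˡ-∑ (suc n) c f = trans (*-distribˡ-+ c (∑ n f) (f n)) (cong (_+ c * f n) (*-distribˡ-∑ n c f))

*-distribʳ-∑ : ∀ n c (f : ℕ → ℕ) → ∑ n f * c ≡ ∑[ i < n ] (f i * c)
*-distribʳ-∑ n c f = trans (*-comm (∑ n f) c) (trans (*-distribˡ-∑ n c f) (∑-cong n (λ i _ → *-comm c (f i))))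

∑-const : ∀ n c → ∑[ i < n ] c ≡ n * c
∑-const zero c = refl
∑-const (suc n) c = trans (cong (_+ c) (∑-const n c)) (+-comm (n * c) c)

∑-zero : ∀ n {f : ℕ → ℕ} → (∀ i → i < n → f i ≡ 0) → ∑ n f ≡ 0
∑-zero n h = trans (∑-cong n h) (trans (∑-const n 0) (*-zeroʳ n))

∑-swap : ∀ m n (f : ℕ → ℕ → ℕ) → ∑[ i < m ] ∑[ j < n ] f i j ≡ ∑[ j < n ] ∑[ i < m ] f i j
∑-swap zero n f = sym (∑-zero n (λ _ _ → refl))
∑-swap (suc m) n f = trans (cong (_+ ∑ n (f m)) (∑-swap m n f)) (sym (∑-distrib-+ n (λ j → ∑[ i < m ] f i j) (f m)))

∑-δ : ∀ n (f : ℕ → ℕ) {j} → j < n → ∑[ i < n ] (𝟙 (j ≟ i) * f i) ≡ f j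
∑-δ (suc n) f {j} j<1+n with j ≟ n
... | yes refl = trans (cong (_+ (f n + 0)) (∑-zero n λ i i<n → cong (_* f i) (𝟙-no (n ≟ i) (<⇒≢ i<n ∘ sym)))) (+-identityʳ (f n))
... | no j≢n = trans (+-identityʳ _) (∑-δ n f (≤∧≢⇒< (≤-pred j<1+n) j≢n))

∑-unique≤1 : ∀ n {P : ℕ → Set} (P? : ∀ i → Dec (P i)) →
             (∀ i j → j < n → i < j → P i → ¬ P j) → ∑[ i < n ] 𝟙 (P? i) ≤ 1
∑-unique≤1 zero P? u = z≤n
∑-unique≤1 (suc n) P? u with P? n
... | no _ = ≤-trans (≤-reflexive (+-identityʳ _)) (∑-unique≤1 n P? (λ i j j<n → u i j (m<n⇒m<1+n j<n)))
... | yes pn = ≤-reflexive (cong (_+ 1) (∑-zero n (λ i i<n → 𝟙-no (P? i) (λ pi → u i n ≤-refl i<n pi pn))))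

-- Grouping the left side by values, each `f y` is counted once per preimage of `y`, hence at most
-- once. Equality under a change of variables comes from using this in both directions.
∑-injective : ∀ m n (π : ℕ → ℕ) (f : ℕ → ℕ) → (∀ i → i < m → π i < n) →
              (∀ i j → j < m → i < j → π i ≢ π j) → ∑[ i < m ] f (π i) ≤ ∑ n f
∑-injective m n π f bound inj = begin
  ∑[ i < m ] f (π i)                                   ≡⟨ ∑-cong m (λ i i<m → ∑-δ n f (bound i i<m)) ⟨
  ∑[ i < m ] ∑[ y < n ] (𝟙 (π i ≟ y) * f y)            ≡⟨ ∑-swap m n _ ⟩
  ∑[ y < n ] ∑[ i < m ] (𝟙 (π i ≟ y) * f y)            ≡⟨ ∑-cong n (λ y _ → *-distribʳ-∑ m (f y) (λ i → 𝟙 (π i ≟ y))) ⟨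
  ∑[ y < n ] ((∑[ i < m ] 𝟙 (π i ≟ y)) * f y)          ≤⟨ ∑-mono n (λ y _ → *-monoˡ-≤ (f y) (∑-unique≤1 m (λ i → π i ≟ y) (λ i j j<m i<j πi≡y πj≡y → inj i j j<m i<j (trans πi≡y (sym πj≡y))))) ⟩
  ∑[ y < n ] (1 * f y)                                 ≡⟨ ∑-cong n (λ y _ → *-identityˡ (f y)) ⟩
  ∑ n f                                                ∎
  where open ≤-Reasoning

∑-splitˡ : ∀ n (f : ℕ → ℕ) → ∑ (suc n) f ≡ f 0 + ∑[ i < n ] f (suc i)
∑-splitˡ zero f = sym (+-identityʳ (f 0))
∑-splitˡ (suc n) f = trans (cong (_+ f (suc n)) (∑-splitˡ n f)) (+-assoc (f 0) _ _)

∑-split : ∀ m n (f : ℕ → ℕ) → ∑ (m + n) f ≡ ∑ m f + ∑[ i < n ] f (m + i)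
∑-split m zero f = trans (cong (λ l → ∑ l f) (+-identityʳ m)) (sym (+-identityʳ _))
∑-split m (suc n) f = trans (cong (λ l → ∑ l f) (+-suc m n)) (trans (cong (_+ f (m + n)) (∑-split m n f)) (+-assoc (∑ m f) _ _))

∣-∑ : ∀ {d} n {f : ℕ → ℕ} → (∀ i → i < n → d ∣ f i) → d ∣ ∑ n f
∣-∑ {d} zero h = d ∣0
∣-∑ (suc n) h = ∣m∣n⇒∣m+n (∣-∑ n (λ i i<n → h i (m<n⇒m<1+n i<n))) (h n ≤-refl)

-- Products, powers and congruences.

0<*⇒0<ˡ : ∀ m n → 0 < m * n → 0 < m
0<*⇒0<ˡ (suc m) n _ = s≤s z≤n

0<*⇒0<ʳ : ∀ m n → 0 < m * n → 0 < n
0<*⇒0<ʳ m n 0<mn = 0<*⇒0<ˡ n m (subst (0 <_) (*-comm m n) 0<mn)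

^-distribʳ-* : ∀ k a b → (a * b) ^ k ≡ a ^ k * b ^ k
^-distribʳ-* zero a b = refl
^-distribʳ-* (suc k) a b = trans (cong (a * b *_) (^-distribʳ-* k a b)) (rearrange a b (a ^ k) (b ^ k))
  where
  rearrange : ∀ a b c d → a * b * (c * d) ≡ a * c * (b * d)
  rearrange = solve-∀

∣⇒∣^ : ∀ {d n} k → 0 < k → d ∣ n → d ∣ n ^ k
∣⇒∣^ {n = n} (suc k) _ d∣n = ∣m⇒∣m*n (n ^ k) d∣n

module _ {n : ℕ} .{{_ : NonZero n}} where

  +-cong-mod : ∀ {a b c d} → a ≡ b [mod n ] → c ≡ d [mod n ] → (a + c) ≡ (b + d) [mod n ]
  +-cong-mod {a} {b} {c} {d} a≡b c≡d = trans (%-distribˡ-+ a c n) (trans (cong₂ (λ u v → (u + v) % n) a≡b c≡d) (sym (%-distribˡ-+ b d n)))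

  *-cong-mod : ∀ {a b c d} → a ≡ b [mod n ] → c ≡ d [mod n ] → (a * c) ≡ (b * d) [mod n ]
  *-cong-mod {a} {b} {c} {d} a≡b c≡d = trans (%-distribˡ-* a c n) (trans (cong₂ (λ u v → (u * v) % n) a≡b c≡d) (sym (%-distribˡ-* b d n)))

  ^-cong-mod : ∀ {a b} k → a ≡ b [mod n ] → (a ^ k) ≡ (b ^ k) [mod n ]
  ^-cong-mod zero a≡b = refl
  ^-cong-mod {a} {b} (suc k) a≡b = *-cong-mod {a} {b} {a ^ k} {b ^ k} a≡b (^-cong-mod k a≡b)

  -- Adding (n - 1)a does the job of adding -a without subtraction: together with `a` it is a
  -- multiple of `n`.
  +-cancelˡ-mod : ∀ a {b c} → (a + b) ≡ (a + c) [mod n ] → b ≡ c [mod n ]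
  +-cancelˡ-mod a {b} {c} eq = begin
    b % n                        ≡⟨ shift b ⟨
    (pred n * a + (a + b)) % n   ≡⟨ +-cong-mod {pred n * a} {pred n * a} {a + b} {a + c} refl eq ⟩
    (pred n * a + (a + c)) % n   ≡⟨ shift c ⟩
    c % n                        ∎
    where
    open ≡-Reasoning
    rearrange : ∀ q x y → q * x + (x + y) ≡ y + x * suc q
    rearrange = solve-∀
    shift : ∀ x → (pred n * a + (a + x)) % n ≡ x % n
    shift x = trans (cong (_% n) (trans (rearrange (pred n) a x) (cong (λ z → x + a * z) (suc-pred n)))) ([m+kn]%n≡m%n x a n)

  mod⇒≡ : ∀ {a b} → a < n → b < n → a ≡ b [mod n ] → a ≡ b
  mod⇒≡ a<n b<n eq = trans (sym (m<n⇒m%n≡m a<n)) (trans eq (m<n⇒m%n≡m b<n))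

  ≡mod⇒∣∸ : ∀ {a b} → a ≤ b → a ≡ b [mod n ] → n ∣ b ∸ a
  ≡mod⇒∣∸ {a} {b} a≤b eq = m%n≡0⇒n∣m (b ∸ a) n (trans (+-cancelˡ-mod a {b ∸ a} {0} (trans (cong (_% n) (m+[n∸m]≡n a≤b)) (trans (sym eq) (cong (_% n) (sym (+-identityʳ a)))))) (m*n%n≡0 0 n))

-- Binomial coefficients modulo a prime.

binomial-theorem : ∀ x n → suc x ^ n ≡ ∑[ j < suc n ] ((n C j) * x ^ j)
binomial-theorem x zero = refl
binomial-theorem x (suc n) = begin
  suc x * suc x ^ n                                              ≡⟨ cong (suc x *_) (binomial-theorem x n) ⟩
  S + x * S                                                      ≡⟨ cong₂ _+_ S≡ (*-distribˡ-∑ (suc n) x _) ⟩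
  1 + (∑[ j < suc n ] ((n C suc j) * x ^ suc j)) + (∑[ j < suc n ] (x * ((n C j) * x ^ j)))
                                                                 ≡⟨ cong suc (∑-distrib-+ (suc n) _ _) ⟨
  1 + ∑[ j < suc n ] ((n C suc j) * x ^ suc j + x * ((n C j) * x ^ j))
                                                                 ≡⟨ cong suc (∑-cong (suc n) (λ j _ → pascal j)) ⟩
  1 + ∑[ j < suc n ] ((suc n C suc j) * x ^ suc j)                 ≡⟨ ∑-splitˡ (suc n) (λ j → (suc n C j) * x ^ j) ⟨
  ∑[ j < suc (suc n) ] ((suc n C j) * x ^ j)                       ∎
  where
  open ≡-Reasoning
  S = ∑[ j < suc n ] ((n C j) * x ^ j)
  -- `S` is extended by the term of index n + 1, whose coefficient is zero, and the term of index 0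
  -- is split off. Both copies of the sum then carry the powers x^(j+1), and Pascal's rule applies
  -- termwise.
  S≡ : S ≡ 1 + ∑[ j < suc n ] ((n C suc j) * x ^ suc j)
  S≡ = trans (sym (trans (cong (λ z → S + z * x ^ suc n) (k>n⇒nCk≡0 (n<1+n n))) (+-identityʳ S)))
             (∑-splitˡ (suc n) (λ j → (n C j) * x ^ j))
  rearrange : ∀ a b x y → b * (x * y) + x * (a * y) ≡ (a + b) * (x * y)
  rearrange = solve-∀
  pascal : ∀ j → (n C suc j) * x ^ suc j + x * ((n C j) * x ^ j) ≡ (suc n C suc j) * x ^ suc j
  pascal j = trans (rearrange (n C j) (n C suc j) x (x ^ j)) (cong (_* x ^ suc j) (nCk+nC[k+1]≡[n+1]C[k+1] n j))

prime⇒>1 : ∀ {p} → Prime p → 1 < p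
prime⇒>1 {p} pr = nonTrivial⇒n>1 p {{prime⇒nonTrivial pr}}

prime∤! : ∀ {p} → Prime p → ∀ j → j < p → p ∤ j !
prime∤! pr zero _ p∣1 = <⇒≢ (prime⇒>1 pr) (sym (∣1⇒≡1 p∣1))
prime∤! pr (suc j) j<p p∣ with euclidsLemma (suc j) (j !) pr p∣
... | inj₁ p∣1+j = >⇒∤ j<p p∣1+j
... | inj₂ p∣j! = prime∤! pr j (<-trans (n<1+n j) j<p) p∣j!

-- `p` divides p! = C(p, j+1) · (j+1)! · (p-j-1)!, and both factorials are products of numbers
-- smaller than `p`.
prime∣C : ∀ {p} → Prime p → ∀ j → suc j < p → p ∣ p C suc j
prime∣C {p} pr j j<p with euclidsLemma (p C suc j) (suc j ! * (p ∸ suc j) !) pr p∣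
  where
  p∣p! : ∀ {n} → 0 < n → n ∣ n !
  p∣p! {suc n} _ = m∣m*n (n !)
  p∣ : p ∣ (p C suc j) * (suc j ! * (p ∸ suc j) !)
  p∣ = subst (p ∣_) (trans (sym (m/n*n≡m {{(suc j) !* (p ∸ suc j) !≢0}} (k![n∸k]!∣n! (<⇒≤ j<p))))
         (cong (_* (suc j ! * (p ∸ suc j) !)) (sym (nCk≡n!/k![n-k]! (<⇒≤ j<p))))) (p∣p! (<-trans (s≤s z≤n) j<p))
... | inj₁ p∣C = p∣C
... | inj₂ p∣ with euclidsLemma (suc j !) ((p ∸ suc j) !) pr p∣
... | inj₁ p∣j! = ⊥-elim (prime∤! pr (suc j) j<p p∣j!)
... | inj₂ p∣j! = ⊥-elim (prime∤! pr (p ∸ suc j) (∸-monoʳ-< (s≤s z≤n) (<⇒≤ j<p)) p∣j!)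

-- Monic polynomials with coefficients in ℕ, lowest degree first, the leading 1 left implicit.
eval : ∀ {d} → Vec ℕ d → ℕ → ℕ
eval [] x = 1
eval (c ∷ cs) x = c + x * eval cs x

-- The summand scaled by `r` has degree one less, so its implicit leading 1 adds `r` to the last
-- stored coefficient and the result stays monic.
addScaled : ∀ {d} → Vec ℕ (suc d) → ℕ → Vec ℕ d → Vec ℕ (suc d)
addScaled (c ∷ cs) r [] = c + r ∷ cs
addScaled (c ∷ cs) r (g ∷ gs) = c + r * g ∷ addScaled cs r gs

eval-addScaled : ∀ {d} (cs : Vec ℕ (suc d)) r (gs : Vec ℕ d) x →
                 eval (addScaled cs r gs) x ≡ eval cs x + r * eval gs x
eval-addScaled (c ∷ cs) r [] x = rearrange c r (x * eval cs x)
  where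
  rearrange : ∀ c r y → c + r + y ≡ c + y + r * 1
  rearrange = solve-∀
eval-addScaled (c ∷ cs) r (g ∷ gs) x =
  trans (cong (λ z → c + r * g + x * z) (eval-addScaled cs r gs x)) (rearrange c r g x (eval cs x) (eval gs x))
  where
  rearrange : ∀ c r g x e h → c + r * g + x * (e + r * h) ≡ c + x * e + r * (g + x * h)
  rearrange = solve-∀

-- Synthetic division: the quotient of f(X) - f(r) by X - r. For f = c + X·h it equals h + r·(h -
-- h(r))/(X - r).
quotientPoly : ∀ {d} → ℕ → Vec ℕ (suc d) → Vec ℕ d
quotientPoly r (c ∷ []) = []
quotientPoly r (c ∷ cs@(_ ∷ _)) = addScaled cs r (quotientPoly r cs)

-- f(x + e) − f(x) = e·g(x), where g depends on the larger point only; no negative coefficient occurs.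
eval-quotient : ∀ {d} (f : Vec ℕ (suc d)) x e →
                eval f (x + e) ≡ eval f x + e * eval (quotientPoly (x + e) f) x
eval-quotient (c ∷ []) x e = rearrange c x e
  where
  rearrange : ∀ c x e → c + (x + e) * 1 ≡ c + x * 1 + e * 1
  rearrange = solve-∀
eval-quotient (c ∷ cs@(_ ∷ _)) x e
  rewrite eval-addScaled cs (x + e) (quotientPoly (x + e) cs) x | eval-quotient cs x e
  = rearrange c x e (eval cs x) (eval (quotientPoly (x + e) cs) x)
  where
  rearrange : ∀ c x e a b → c + (x + e) * (a + e * b) ≡ c + x * a + e * (a + (x + e) * b)
  rearrange = solve-∀

eval-binomial : ∀ k c x → eval (c ∷ replicate k 0) x ≡ c + x ^ suc k
eval-binomial zero c x = refl
eval-binomial (suc k) c x = cong (λ z → c + x * z) (eval-binomial k 0 x)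

-- Fermat's little theorem, power maps and sums over residues.

Periodic : (p : ℕ) → .{{NonZero p}} → (ℕ → ℕ) → Set
Periodic p f = ∀ x y → x ≡ y [mod p ] → f x ≡ f y

module PrimeModulus {p : ℕ} .{{_ : NonZero p}} (pr : Prime p) where

  -- Induction on `x`: the inner binomial coefficients vanish modulo `p`, so (x + 1)^p ≡ x^p + 1.
  x^p≡x : ∀ x → (x ^ p) ≡ x [mod p ]
  x^p≡x zero = cong (_% p) (0^ p (<-trans (s≤s z≤n) (prime⇒>1 pr)))
    where
    0^ : ∀ n → 0 < n → 0 ^ n ≡ 0
    0^ (suc n) _ = refl
  x^p≡x (suc x) = begin
    suc x ^ p % p                 ≡⟨ cong (_% p) (expand p (<-trans (s≤s z≤n) (prime⇒>1 pr))) ⟩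
    (middle + (1 + x ^ p)) % p    ≡⟨ %-remove-+ˡ (1 + x ^ p) (∣-∑ (pred p) (λ j j<p → ∣m⇒∣m*n (x ^ suc j) (prime∣C pr j (subst (suc j <_) (suc-pred p) (s≤s j<p))))) ⟩
    (1 + x ^ p) % p               ≡⟨ +-cong-mod {n = p} {1} {1} {x ^ p} {x} refl (x^p≡x x) ⟩
    suc x % p                     ∎
    where
    open ≡-Reasoning
    middle = ∑[ j < pred p ] ((p C suc j) * x ^ suc j)
    rearrange : ∀ m y → 1 + m + y ≡ m + (1 + y)
    rearrange = solve-∀
    expand : ∀ n → 0 < n → suc x ^ n ≡ (∑[ j < pred n ] ((n C suc j) * x ^ suc j)) + (1 + x ^ n)
    expand (suc n) _ = begin
      suc x ^ suc n                                                        ≡⟨ binomial-theorem x (suc n) ⟩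
      ∑[ j < suc n ] ((suc n C j) * x ^ j) + (suc n C suc n) * x ^ suc n     ≡⟨ cong₂ _+_ (∑-splitˡ n (λ j → (suc n C j) * x ^ j)) (trans (cong (_* x ^ suc n) (nCn≡1 (suc n))) (*-identityˡ (x ^ suc n))) ⟩
      1 + (∑[ j < n ] ((suc n C suc j) * x ^ suc j)) + x ^ suc n             ≡⟨ rearrange (∑[ j < n ] ((suc n C suc j) * x ^ suc j)) (x ^ suc n) ⟩
      ∑[ j < n ] ((suc n C suc j) * x ^ suc j) + (1 + x ^ suc n)             ∎

  *-cancelˡ-mod-≤ : ∀ a {b c} → p ∤ a → b ≤ c → (a * b) ≡ (a * c) [mod p ] → b ≡ c [mod p ]
  *-cancelˡ-mod-≤ a {b} {c} p∤a b≤c eq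
    with euclidsLemma a (c ∸ b) pr (subst (p ∣_) (sym (*-distribˡ-∸ a c b)) (≡mod⇒∣∸ (*-monoʳ-≤ a b≤c) eq))
  ... | inj₁ p∣a = ⊥-elim (p∤a p∣a)
  ... | inj₂ p∣d = trans (sym (%-remove-+ʳ b p∣d)) (cong (_% p) (m+[n∸m]≡n b≤c))

  *-cancelˡ-mod : ∀ a {b c} → p ∤ a → (a * b) ≡ (a * c) [mod p ] → b ≡ c [mod p ]
  *-cancelˡ-mod a {b} {c} p∤a eq with ≤-total b c
  ... | inj₁ b≤c = *-cancelˡ-mod-≤ a p∤a b≤c eq
  ... | inj₂ c≤b = sym (*-cancelˡ-mod-≤ a p∤a c≤b (sym eq))

  fermat : ∀ x → p ∤ x → (x ^ (p ∸ 1)) ≡ 1 [mod p ]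
  fermat x p∤x = *-cancelˡ-mod x p∤x (trans (cong (λ e → x ^ e % p) (suc-pred p)) (trans (x^p≡x x) (cong (_% p) (sym (*-identityʳ x)))))

  -- Lagrange's bound, going down from the largest residue. If `n` is a root, then f(n) - f(x) = (n
  -- - x)·g(x) with 0 < n - x < p, so every smaller root of `f` is a root of the quotient `g`, whose
  -- degree is one less.
  count-roots : ∀ n → n ≤ p → ∀ {d} (f : Vec ℕ d) → ∑[ x < n ] 𝟙 (p ∣? eval f x) ≤ d
  count-roots zero _ f = z≤n
  count-roots (suc n) n<p f with p ∣? eval f n
  ... | no _ = ≤-trans (≤-reflexive (+-identityʳ _)) (count-roots n (<⇒≤ n<p) f)
  count-roots (suc n) n<p [] | yes p∣1 = ⊥-elim (<⇒≢ (prime⇒>1 pr) (sym (∣1⇒≡1 p∣1)))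
  count-roots (suc n) n<p {suc d} f@(_ ∷ _) | yes p∣fn = begin
    ∑[ x < n ] 𝟙 (p ∣? eval f x) + 1  ≤⟨ +-monoˡ-≤ 1 (∑-mono n (λ x x<n → 𝟙-mono (p ∣? eval f x) (p ∣? eval g x) (root x x<n))) ⟩
    ∑[ x < n ] 𝟙 (p ∣? eval g x) + 1  ≤⟨ +-monoˡ-≤ 1 (count-roots n (<⇒≤ n<p) g) ⟩
    d + 1                             ≡⟨ +-comm d 1 ⟩
    suc d                             ∎
    where
    open ≤-Reasoning
    g = quotientPoly n f
    root : ∀ x → x < n → p ∣ eval f x → p ∣ eval g x
    root x x<n p∣fx with euclidsLemma (n ∸ x) (eval g x) pr
      (∣m+n∣m⇒∣n (subst (p ∣_) (subst (λ r → eval f r ≡ eval f x + (n ∸ x) * eval (quotientPoly r f) x) (m+[n∸m]≡n (<⇒≤ x<n)) (eval-quotient f x (n ∸ x))) p∣fn) p∣fx)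
    ... | inj₂ p∣gx = p∣gx
    ... | inj₁ p∣n-x = ⊥-elim (>⇒∤ {{>-nonZero (m<n⇒0<n∸m x<n)}} (≤-<-trans (m∸n≤m n x) n<p) p∣n-x)

  count-kth-roots : ∀ k z → z < p → 0 < k → ∑[ x < p ] 𝟙 (x ^ k % p ≟ z) ≤ k
  count-kth-roots (suc k) z z<p _ = ≤-trans
    (∑-mono p (λ x _ → 𝟙-mono (x ^ suc k % p ≟ z) (p ∣? eval f x) (λ eq → subst (p ∣_) (sym (eval-binomial k (p ∸ z) x)) (divides-sum x eq))))
    (count-roots p ≤-refl f)
    where
    -- The constant term p - z represents -z, so `f` is X^(k+1) - z modulo `p`.
    f = p ∸ z ∷ replicate k 0
    divides-sum : ∀ x → x ^ suc k % p ≡ z → p ∣ p ∸ z + x ^ suc k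
    divides-sum x eq = m%n≡0⇒n∣m _ p (trans
      (+-cong-mod {n = p} {p ∸ z} {p ∸ z} {x ^ suc k} {z} refl (trans eq (sym (m<n⇒m%n≡m z<p))))
      (trans (cong (_% p) (m∸n+n≡m (<⇒≤ z<p))) (n%n≡0 p)))

  -- x ↦ xᵏ maps the mk units to the at most m roots of zᵐ = 1 with fibres of size at most k, so all fibres are full.
  fibre-size-≥ : ∀ m k → p ∸ 1 ≡ m * k → 0 < m → 0 < k → ∀ {z} → z < p → z ^ m % p ≡ 1 →
                 k ≤ ∑[ x < p ] 𝟙 (x ^ k % p ≟ z)
  fibre-size-≥ m k p-1≡mk 0<m 0<k {z₀} z₀<p z₀^m≡1 = +-cancelˡ-≤ (m * k) k (F z₀) (begin
    m * k + k                                                        ≤⟨ +-monoˡ-≤ k total ⟩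
    ∑[ z < p ] (F z * R z) + k                                       ≡⟨ cong (∑[ z < p ] (F z * R z) +_) (∑-δ p (λ _ → k) z₀<p) ⟨
    ∑[ z < p ] (F z * R z) + ∑[ z < p ] (𝟙 (z₀ ≟ z) * k)             ≡⟨ ∑-distrib-+ p _ _ ⟨
    ∑[ z < p ] (F z * R z + 𝟙 (z₀ ≟ z) * k)                          ≤⟨ ∑-mono p pointwise ⟩
    ∑[ z < p ] (R z * k + 𝟙 (z₀ ≟ z) * F z)                          ≡⟨ ∑-distrib-+ p _ _ ⟩
    ∑[ z < p ] (R z * k) + ∑[ z < p ] (𝟙 (z₀ ≟ z) * F z)             ≡⟨ cong₂ _+_ (sym (*-distribʳ-∑ p k R)) (∑-δ p F z₀<p) ⟩
    ∑ p R * k + F z₀                                                 ≤⟨ +-monoˡ-≤ (F z₀) (*-monoˡ-≤ k (count-kth-roots m 1 (prime⇒>1 pr) 0<m)) ⟩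
    m * k + F z₀                                                     ∎)
    where
    open ≤-Reasoning
    F R : ℕ → ℕ
    F z = ∑[ x < p ] 𝟙 (x ^ k % p ≟ z)
    R z = 𝟙 (z ^ m % p ≟ 1)
    root : ∀ i → i < pred p → ((suc i ^ k) % p) ^ m % p ≡ 1
    root i i<p-1 = trans (^-cong-mod {n = p} m (m%n%n≡m%n (suc i ^ k) p))
      (trans (cong (_% p) (trans (^-*-assoc (suc i) k m) (cong (suc i ^_) (trans (*-comm k m) (sym p-1≡mk)))))
      (trans (fermat (suc i) (>⇒∤ (subst (suc i <_) (suc-pred p) (s≤s i<p-1)))) (m<n⇒m%n≡m (prime⇒>1 pr))))
    total : m * k ≤ ∑[ z < p ] (F z * R z)
    total = begin
      m * k                                                     ≡⟨ trans (sym p-1≡mk) (trans (sym (*-identityʳ (pred p))) (sym (∑-const (pred p) 1))) ⟩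
      ∑[ i < pred p ] 1                                         ≡⟨ ∑-cong (pred p) (λ i i<p-1 → sym (𝟙-yes (_ ≟ 1) (root i i<p-1))) ⟩
      ∑[ i < pred p ] R (suc i ^ k % p)                         ≤⟨ ∑-injective (pred p) p suc (λ x → R (x ^ k % p)) (λ i i<p-1 → subst (suc i <_) (suc-pred p) (s≤s i<p-1)) (λ i j _ i<j eq → <⇒≢ i<j (suc-injective eq)) ⟩
      ∑[ x < p ] R (x ^ k % p)                                  ≡⟨ ∑-cong p (λ x _ → sym (∑-δ p R (m%n<n (x ^ k) p))) ⟩
      ∑[ x < p ] ∑[ z < p ] (𝟙 (x ^ k % p ≟ z) * R z)           ≡⟨ ∑-swap p p _ ⟩
      ∑[ z < p ] ∑[ x < p ] (𝟙 (x ^ k % p ≟ z) * R z)           ≡⟨ ∑-cong p (λ z _ → sym (*-distribʳ-∑ p (R z) _)) ⟩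
      ∑[ z < p ] (F z * R z)                                    ∎
    -- Away from `z₀` this is the bound `k` on a fibre; at `z₀` both sides agree because `R z₀` is
    -- 1. The indicator terms move the fibre over `z₀` across the inequality without subtraction.
    pointwise : ∀ z → z < p → F z * R z + 𝟙 (z₀ ≟ z) * k ≤ R z * k + 𝟙 (z₀ ≟ z) * F z
    pointwise z z<p with z₀ ≟ z
    ... | no _ = +-monoˡ-≤ 0 (≤-trans (≤-reflexive (*-comm (F z) (R z))) (*-monoʳ-≤ (R z) (count-kth-roots k z z<p 0<k)))
    ... | yes refl = ≤-reflexive (trans (cong (λ r → F z * r + 1 * k) r≡1) (trans (rearrange (F z) k) (cong (λ r → r * k + 1 * F z) (sym r≡1))))
      where
      r≡1 : R z ≡ 1
      r≡1 = 𝟙-yes (_ ≟ 1) z₀^m≡1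
      rearrange : ∀ f k → f * 1 + 1 * k ≡ 1 * k + 1 * f
      rearrange = solve-∀

  fibre-size : ∀ m k → p ∸ 1 ≡ m * k → 0 < m → 0 < k → ∀ {z} → z < p → z ^ m % p ≡ 1 →
               ∑[ x < p ] 𝟙 (x ^ k % p ≟ z) ≡ k
  fibre-size m k p-1≡mk 0<m 0<k {z} z<p z^m≡1 =
    ≤-antisym (count-kth-roots k z z<p 0<k) (fibre-size-≥ m k p-1≡mk 0<m 0<k z<p z^m≡1)

  ∑-affine-≤ : ∀ {f} → Periodic p f → ∀ d c → p ∤ d → ∑[ t < p ] f (t * d + c) ≤ ∑ p f
  ∑-affine-≤ {f} per d c p∤d = ≤-trans
    (≤-reflexive (∑-cong p (λ t _ → per _ _ (sym (m%n%n≡m%n (t * d + c) p)))))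
    (∑-injective p p (λ t → (t * d + c) % p) f (λ t _ → m%n<n _ p) inj)
    where
    inj : ∀ i j → j < p → i < j → (i * d + c) % p ≢ (j * d + c) % p
    inj i j j<p i<j eq = <⇒≢ i<j (mod⇒≡ (<-trans i<j j<p) j<p (*-cancelˡ-mod d p∤d (+-cancelˡ-mod c
      (trans (cong (_% p) (comm i)) (trans eq (cong (_% p) (sym (comm j))))))))
      where
      comm : ∀ x → c + d * x ≡ x * d + c
      comm x = trans (+-comm c (d * x)) (cong (_+ c) (*-comm d x))

  ∑-translate-≤ : ∀ {f} → Periodic p f → ∀ a → ∑[ c < p ] f (a + c) ≤ ∑ p f
  ∑-translate-≤ {f} per a = ≤-trans
    (≤-reflexive (∑-cong p (λ c _ → cong f (trans (+-comm a c) (cong (_+ a) (sym (*-identityʳ c)))))))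
    (∑-affine-≤ per 1 a (>⇒∤ (prime⇒>1 pr)))

  -- The reverse inequality translates back by (p - 1)a, which represents -a.
  ∑-translate : ∀ {f} → Periodic p f → ∀ a → ∑[ c < p ] f (a + c) ≡ ∑ p f
  ∑-translate {f} per a = ≤-antisym (∑-translate-≤ per a) (≤-trans
    (≤-reflexive (∑-cong p (λ c _ → per _ _ (sym (trans (cong (_% p) (trans (rearrange a (pred p) c) (cong (λ q → c + a * q) (suc-pred p)))) ([m+kn]%n≡m%n c a p))))))
    (∑-translate-≤ {λ c → f (a + c)} (λ x y eq → per _ _ (+-cong-mod {n = p} {a} {a} {x} {y} refl eq)) (pred p * a)))
    where
    rearrange : ∀ a q c → a + (q * a + c) ≡ c + a * suc q
    rearrange = solve-∀

  -- For x ≠ y the pair (tx + c, ty + c) determines (t, c). Taking tx + c as the new intercept turns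
  -- ty + c into t(y - x) + c, and then `t` varies, with y - x invertible.
  ∑-lines-≤ : ∀ {f g} → Periodic p f → Periodic p g → ∀ x y → x < p → y < p → x ≢ y →
              ∑[ t < p ] ∑[ c < p ] (f (t * x + c) * g (t * y + c)) ≤ ∑ p f * ∑ p g
  ∑-lines-≤ {f} {g} perf perg x y x<p y<p x≢y = begin
    ∑[ t < p ] ∑[ c < p ] (f (t * x + c) * g (t * y + c))   ≡⟨ ∑-cong p (λ t _ → ∑-cong p (λ c _ → cong (f (t * x + c) *_) (perg _ _ (sym (shift t c))))) ⟩
    ∑[ t < p ] ∑[ c < p ] G t (t * x + c)                   ≤⟨ ∑-mono p (λ t _ → ∑-translate-≤ (perG t) (t * x)) ⟩
    ∑[ t < p ] ∑[ c < p ] G t c                             ≡⟨ ∑-swap p p G ⟩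
    ∑[ c < p ] ∑[ t < p ] (f c * g (t * d + c))             ≡⟨ ∑-cong p (λ c _ → sym (*-distribˡ-∑ p (f c) _)) ⟩
    ∑[ c < p ] (f c * ∑[ t < p ] g (t * d + c))             ≤⟨ ∑-mono p (λ c _ → *-monoʳ-≤ (f c) (∑-affine-≤ perg d c p∤d)) ⟩
    ∑[ c < p ] (f c * ∑ p g)                                ≡⟨ *-distribʳ-∑ p (∑ p g) f ⟨
    ∑ p f * ∑ p g                                           ∎
    where
    open ≤-Reasoning
    -- d ≡ y − x modulo p
    d = y + pred p * x
    G : ℕ → ℕ → ℕ
    G t c = f c * g (t * d + c)
    perG : ∀ t → Periodic p (G t)
    perG t a b eq = cong₂ _*_ (perf _ _ eq) (perg _ _ (+-cong-mod {n = p} {t * d} {t * d} {a} {b} refl eq))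
    rearrange : ∀ t x y c q → t * (y + q * x) + (t * x + c) ≡ (t * y + c) + (t * x) * suc q
    rearrange = solve-∀
    shift : ∀ t c → (t * d + (t * x + c)) % p ≡ (t * y + c) % p
    shift t c = trans (cong (_% p) (trans (rearrange t x y c (pred p)) (cong (λ q → t * y + c + t * x * q) (suc-pred p)))) ([m+kn]%n≡m%n (t * y + c) (t * x) p)
    x+d : ∀ x y q → x + (y + q * x) ≡ y + x * suc q
    x+d = solve-∀
    p∤d : p ∤ d
    p∤d p∣d = x≢y (mod⇒≡ x<p y<p (trans (sym (%-remove-+ʳ x p∣d)) (trans (cong (_% p) (trans (x+d x y (pred p)) (cong (λ q → y + x * q) (suc-pred p)))) ([m+kn]%n≡m%n y x p))))

-- Incidences of lines with a product set.

module SecondMoment {p : ℕ} .{{_ : NonZero p}} (pr : Prime p)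
  (A : ℕ → ℕ) (A-periodic : Periodic p A) (A-idem : ∀ x → A x * A x ≡ A x) where
  open PrimeModulus pr

  α : ℕ
  α = ∑ p A

  -- With `A` the indicator of a set, the number of points of its square on the line of slope `t`
  -- and intercept `c`.
  incidences : ℕ → ℕ → ℕ
  incidences t c = ∑[ x < p ] (A x * A (t * x + c))

  first-moment : ∑[ t < p ] ∑[ c < p ] incidences t c ≡ p * (α * α)
  first-moment = trans (∑-cong p (λ t _ → per-slope t)) (∑-const p (α * α))
    where
    open ≡-Reasoning
    per-slope : ∀ t → ∑[ c < p ] incidences t c ≡ α * α
    per-slope t = begin
      ∑[ c < p ] ∑[ x < p ] (A x * A (t * x + c))   ≡⟨ ∑-swap p p _ ⟩
      ∑[ x < p ] ∑[ c < p ] (A x * A (t * x + c))   ≡⟨ ∑-cong p (λ x _ → trans (sym (*-distribˡ-∑ p (A x) _)) (cong (A x *_) (∑-translate A-periodic (t * x)))) ⟩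
      ∑[ x < p ] (A x * α)                          ≡⟨ *-distribʳ-∑ p α A ⟨
      α * α                                         ∎

  -- the number of lines through two points of A × A above x and y
  joint : ℕ → ℕ → ℕ
  joint x y = ∑[ t < p ] ∑[ c < p ] (A (t * x + c) * A (t * y + c))

  -- For x ≠ y, two points above `x` and `y` lie on just one line; for x = y, each of the α points
  -- lies on `p` lines. The indicator puts both cases into one inequality, ready to be summed.
  joint-bound : ∀ x y → x < p → y < p → joint x y + 𝟙 (x ≟ y) * (α * α) ≤ α * α + 𝟙 (x ≟ y) * (p * α)
  joint-bound x y x<p y<p with x ≟ y
  ... | no x≢y = +-monoˡ-≤ 0 (∑-lines-≤ A-periodic A-periodic x y x<p y<p x≢y)
  ... | yes refl = ≤-reflexive (trans (cong (_+ 1 * (α * α)) diagonal) (rearrange (p * α) (α * α)))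
    where
    rearrange : ∀ a b → a + 1 * b ≡ b + 1 * a
    rearrange = solve-∀
    diagonal : joint x x ≡ p * α
    diagonal = trans (∑-cong p (λ t _ → trans (∑-cong p (λ c _ → A-idem (t * x + c))) (∑-translate A-periodic (t * x)))) (∑-const p α)

  ∑-square : ∀ (f : ℕ → ℕ) → ∑ p f * ∑ p f ≡ ∑[ x < p ] ∑[ y < p ] (f x * f y)
  ∑-square f = trans (*-distribʳ-∑ p (∑ p f) f) (∑-cong p (λ x _ → *-distribˡ-∑ p (f x) f))

  -- A squared incidence number counts pairs of points on the same line; exchanging the summations
  -- fixes the abscissae `x` and `y` before the line.
  second-moment≡ : ∑[ t < p ] ∑[ c < p ] (incidences t c * incidences t c) ≡ ∑[ x < p ] ∑[ y < p ] (A x * A y * joint x y)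
  second-moment≡ = begin
    ∑[ t < p ] ∑[ c < p ] (incidences t c * incidences t c)            ≡⟨ ∑-cong p (λ t _ → ∑-cong p (λ c _ → ∑-square _)) ⟩
    ∑[ t < p ] ∑[ c < p ] ∑[ x < p ] ∑[ y < p ] K t c x y              ≡⟨ ∑-cong p (λ t _ → ∑-swap p p _) ⟩
    ∑[ t < p ] ∑[ x < p ] ∑[ c < p ] ∑[ y < p ] K t c x y              ≡⟨ ∑-swap p p _ ⟩
    ∑[ x < p ] ∑[ t < p ] ∑[ c < p ] ∑[ y < p ] K t c x y              ≡⟨ ∑-cong p (λ x _ → ∑-cong p (λ t _ → ∑-swap p p _)) ⟩
    ∑[ x < p ] ∑[ t < p ] ∑[ y < p ] ∑[ c < p ] K t c x y              ≡⟨ ∑-cong p (λ x _ → ∑-swap p p _) ⟩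
    ∑[ x < p ] ∑[ y < p ] ∑[ t < p ] ∑[ c < p ] K t c x y              ≡⟨ ∑-cong p (λ x _ → ∑-cong p (λ y _ → factor x y)) ⟩
    ∑[ x < p ] ∑[ y < p ] (A x * A y * joint x y)                      ∎
    where
    open ≡-Reasoning
    K : ℕ → ℕ → ℕ → ℕ → ℕ
    K t c x y = A x * A (t * x + c) * (A y * A (t * y + c))
    rearrange : ∀ a b c d → a * b * (c * d) ≡ a * c * (b * d)
    rearrange = solve-∀
    factor : ∀ x y → ∑[ t < p ] ∑[ c < p ] K t c x y ≡ A x * A y * joint x y
    factor x y = sym (trans (*-distribˡ-∑ p (A x * A y) _) (∑-cong p (λ t _ →
      trans (*-distribˡ-∑ p (A x * A y) _) (∑-cong p (λ c _ → sym (rearrange (A x) (A (t * x + c)) (A y) (A (t * y + c))))))))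

  -- On the diagonal the weight `A x * A x` collapses to `A x`. This serves to sum both sides of
  -- `joint-bound`.
  ∑∑-offset : ∀ (J : ℕ → ℕ → ℕ) u →
              ∑[ x < p ] ∑[ y < p ] (A x * A y * (J x y + 𝟙 (x ≟ y) * u)) ≡ ∑[ x < p ] ∑[ y < p ] (A x * A y * J x y) + α * u
  ∑∑-offset J u = begin
    ∑[ x < p ] ∑[ y < p ] (A x * A y * (J x y + 𝟙 (x ≟ y) * u))
      ≡⟨ ∑-cong p (λ x _ → trans (∑-cong p (λ y _ → rearrange (A x) (A y) (J x y) (𝟙 (x ≟ y)) u)) (∑-distrib-+ p _ _)) ⟩
    ∑[ x < p ] (∑[ y < p ] (A x * A y * J x y) + ∑[ y < p ] (𝟙 (x ≟ y) * (A x * A y * u)))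
      ≡⟨ ∑-distrib-+ p _ _ ⟩
    ∑[ x < p ] ∑[ y < p ] (A x * A y * J x y) + ∑[ x < p ] ∑[ y < p ] (𝟙 (x ≟ y) * (A x * A y * u))
      ≡⟨ cong (∑[ x < p ] ∑[ y < p ] (A x * A y * J x y) +_) (∑-cong p (λ x x<p → trans (∑-δ p (λ y → A x * A y * u) x<p) (cong (_* u) (A-idem x)))) ⟩
    ∑[ x < p ] ∑[ y < p ] (A x * A y * J x y) + ∑[ x < p ] (A x * u)
      ≡⟨ cong (∑[ x < p ] ∑[ y < p ] (A x * A y * J x y) +_) (sym (*-distribʳ-∑ p u A)) ⟩
    ∑[ x < p ] ∑[ y < p ] (A x * A y * J x y) + α * u ∎
    where
    open ≡-Reasoning
    rearrange : ∀ a b j e u → a * b * (j + e * u) ≡ a * b * j + e * (a * b * u)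
    rearrange = solve-∀

  second-moment-≤ : ∑[ t < p ] ∑[ c < p ] (incidences t c * incidences t c) + α * (α * α) ≤ α * α * (α * α) + α * (p * α)
  second-moment-≤ = begin
    ∑[ t < p ] ∑[ c < p ] (incidences t c * incidences t c) + α * (α * α)          ≡⟨ cong (_+ α * (α * α)) second-moment≡ ⟩
    ∑[ x < p ] ∑[ y < p ] (A x * A y * joint x y) + α * (α * α)                    ≡⟨ ∑∑-offset joint (α * α) ⟨
    ∑[ x < p ] ∑[ y < p ] (A x * A y * (joint x y + 𝟙 (x ≟ y) * (α * α)))          ≤⟨ ∑-mono p (λ x x<p → ∑-mono p (λ y y<p → *-monoʳ-≤ (A x * A y) (joint-bound x y x<p y<p))) ⟩
    ∑[ x < p ] ∑[ y < p ] (A x * A y * (α * α + 𝟙 (x ≟ y) * (p * α)))              ≡⟨ ∑∑-offset (λ _ _ → α * α) (p * α) ⟩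
    ∑[ x < p ] ∑[ y < p ] (A x * A y * (α * α)) + α * (p * α)                      ≡⟨ cong (_+ α * (p * α)) constant ⟩
    α * α * (α * α) + α * (p * α)                                                  ∎
    where
    open ≤-Reasoning
    constant : ∑[ x < p ] ∑[ y < p ] (A x * A y * (α * α)) ≡ α * α * (α * α)
    constant = trans (∑-cong p (λ x _ → sym (*-distribʳ-∑ p (α * α) _)))
      (trans (sym (*-distribʳ-∑ p (α * α) _)) (cong (_* (α * α)) (sym (∑-square A))))

  -- Chebyshev's argument. With Y the sum of the squared incidences i², the sum of (p·i - α²)² over
  -- all lines is p²Y - p²α⁴, and the (∑H)² empty lines alone contribute (∑H)²α⁴. `second-moment-≤`
  -- bounds Y - α⁴ by pα² - α³, and dividing by α² gives the claim.
  empty-lines : ∀ {H : ℕ → ℕ} → (∀ t → H t ≤ 1) → (∀ t c → 0 < H t * H c → incidences t c ≡ 0) → 0 < α →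
                ∑ p H * ∑ p H * (α * α) + p * p * α ≤ p * p * p
  empty-lines {H} H≤1 empty 0<α = *-cancelˡ-≤ (α * α) {{>-nonZero (*-mono-≤ 0<α 0<α)}} (+-cancelˡ-≤ (2 * (p * p * (a * a))) _ _ (begin
    2 * (p * p * (a * a)) + a * (h * a + p * p * α)                      ≡⟨ rearrange₁ p α h ⟩
    (2 * (p * a) * (p * a) + h * (a * a)) + p * p * (α * a)              ≤⟨ +-monoˡ-≤ (p * p * (α * a)) summed ⟩
    (p * p * Y + p * p * (a * a)) + p * p * (α * a)                      ≡⟨ rearrange₂ (p * p) Y (a * a) (α * a) ⟩
    p * p * (Y + α * a) + p * p * (a * a)                                ≤⟨ +-monoˡ-≤ (p * p * (a * a)) (*-monoʳ-≤ (p * p) second-moment-≤) ⟩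
    p * p * (a * a + α * (p * α)) + p * p * (a * a)                      ≡⟨ rearrange₃ p α ⟩
    2 * (p * p * (a * a)) + a * (p * p * p)                              ∎))
    where
    open ≤-Reasoning
    a = α * α
    h = ∑ p H * ∑ p H
    Y = ∑[ t < p ] ∑[ c < p ] (incidences t c * incidences t c)
    rearrange₁ : ∀ p α h → 2 * (p * p * (α * α * (α * α))) + α * α * (h * (α * α) + p * p * α) ≡
                 (2 * (p * (α * α)) * (p * (α * α)) + h * (α * α * (α * α))) + p * p * (α * (α * α))
    rearrange₁ = solve-∀
    rearrange₂ : ∀ q y b c → q * y + q * b + q * c ≡ q * (y + c) + q * b
    rearrange₂ = solve-∀
    rearrange₃ : ∀ p α → p * p * (α * α * (α * α) + α * (p * α)) + p * p * (α * α * (α * α)) ≡ 2 * (p * p * (α * α * (α * α))) + α * α * (p * p * p)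
    rearrange₃ = solve-∀
    2xy≤x²+y²′ : ∀ x d → 2 * x * (x + d) ≤ x * x + (x + d) * (x + d)
    2xy≤x²+y²′ x d = ≤-trans (m≤m+n _ (d * d)) (≤-reflexive (expand x d))
      where
      expand : ∀ x d → 2 * x * (x + d) + d * d ≡ x * x + (x + d) * (x + d)
      expand = solve-∀
    2xy≤x²+y² : ∀ x y → 2 * x * y ≤ x * x + y * y
    2xy≤x²+y² x y with ≤-total x y
    ... | inj₁ x≤y = subst (λ z → 2 * x * z ≤ x * x + z * z) (m+[n∸m]≡n x≤y) (2xy≤x²+y²′ x (y ∸ x))
    ... | inj₂ y≤x = subst (λ z → 2 * z * y ≤ z * z + y * y) (m+[n∸m]≡n y≤x)
      (≤-trans (≤-reflexive (swap y (y + (x ∸ y)))) (≤-trans (2xy≤x²+y²′ y (x ∸ y)) (≤-reflexive (+-comm (y * y) _))))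
      where
      swap : ∀ u v → 2 * v * u ≡ 2 * u * v
      swap = solve-∀
    -- (p·i − α²)² ≥ 0 on every line, with value α⁴ on the empty ones
    pointwise : ∀ t c → 2 * (p * a) * incidences t c + H t * H c * (a * a) ≤ p * p * (incidences t c * incidences t c) + a * a
    pointwise t c with H t * H c in eq
    ... | zero = ≤-trans (≤-reflexive (scale p a (incidences t c))) (≤-trans (2xy≤x²+y² (p * incidences t c) a) (≤-reflexive (cong (_+ a * a) (square p (incidences t c)))))
      where
      scale : ∀ p a i → 2 * (p * a) * i + 0 ≡ 2 * (p * i) * a
      scale = solve-∀
      square : ∀ p i → p * i * (p * i) ≡ p * p * (i * i)
      square = solve-∀
    ... | suc n rewrite empty t c (subst (0 <_) (sym eq) (s≤s z≤n)) = begin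
      2 * (p * a) * 0 + suc n * (a * a)      ≡⟨ cong (_+ suc n * (a * a)) (*-zeroʳ (2 * (p * a))) ⟩
      suc n * (a * a)                        ≤⟨ *-monoˡ-≤ (a * a) (subst (_≤ 1) eq (*-mono-≤ (H≤1 t) (H≤1 c))) ⟩
      1 * (a * a)                            ≡⟨ *-identityˡ (a * a) ⟩
      a * a                                  ≤⟨ m≤n+m (a * a) (p * p * (0 * 0)) ⟩
      p * p * (0 * 0) + a * a                ∎
    ∑∑ : (ℕ → ℕ → ℕ) → ℕ
    ∑∑ f = ∑[ t < p ] ∑[ c < p ] f t c
    ∑∑-+ : ∀ f g → ∑∑ (λ t c → f t c + g t c) ≡ ∑∑ f + ∑∑ g
    ∑∑-+ f g = trans (∑-cong p (λ t _ → ∑-distrib-+ p (f t) (g t))) (∑-distrib-+ p _ _)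
    ∑∑-* : ∀ u f → ∑∑ (λ t c → u * f t c) ≡ u * ∑∑ f
    ∑∑-* u f = sym (trans (*-distribˡ-∑ p u _) (∑-cong p (λ t _ → *-distribˡ-∑ p u (f t))))
    summed : 2 * (p * a) * (p * a) + h * (a * a) ≤ p * p * Y + p * p * (a * a)
    summed = begin
      2 * (p * a) * (p * a) + h * (a * a)
        ≡⟨ cong₂ _+_ (trans (cong (2 * (p * a) *_) (sym first-moment)) (sym (∑∑-* (2 * (p * a)) incidences)))
                     (trans (cong (_* (a * a)) (∑-square H)) (trans (*-comm _ (a * a)) (trans (sym (∑∑-* (a * a) (λ t c → H t * H c))) (∑-cong p (λ t _ → ∑-cong p (λ c _ → *-comm (a * a) _)))))) ⟩
      ∑∑ (λ t c → 2 * (p * a) * incidences t c) + ∑∑ (λ t c → H t * H c * (a * a))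
        ≡⟨ ∑∑-+ (λ t c → 2 * (p * a) * incidences t c) (λ t c → H t * H c * (a * a)) ⟨
      ∑∑ (λ t c → 2 * (p * a) * incidences t c + H t * H c * (a * a))
        ≤⟨ ∑-mono p (λ t _ → ∑-mono p (λ c _ → pointwise t c)) ⟩
      ∑∑ (λ t c → p * p * (incidences t c * incidences t c) + a * a)
        ≡⟨ trans (∑∑-+ (λ t c → p * p * (incidences t c * incidences t c)) (λ _ _ → a * a)) (cong₂ _+_ (∑∑-* (p * p) (λ t c → incidences t c * incidences t c)) (trans (trans (∑-cong p (λ _ _ → ∑-const p (a * a))) (∑-const p (p * (a * a)))) (sym (*-assoc p p (a * a))))) ⟩
      p * p * Y + p * p * (a * a) ∎

-- With m = 1 + m′, the hypothesis reads k > m³ − m².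
second-moment-gap : ∀ m′ k → 3 ≤ m′ → 1 + suc m′ * suc m′ * m′ ≤ k →
  let p = 1 + suc m′ * k in p * p * p < k * k * (k * k) + p * p * k
second-moment-gap m′ k 3≤m′ big = begin-strict
  p * p * p                                   ≡⟨ split m′ k ⟩
  p * p * (m′ * k + 1) + p * p * k            <⟨ +-monoˡ-< (p * p * k) dominated ⟩
  k * k * (k * k) + p * p * k                 ∎
  where
  open ≤-Reasoning
  m = suc m′
  p = 1 + m * k
  s = m * m * m′
  split : ∀ m′ k → let p = 1 + suc m′ * k in p * p * p ≡ p * p * (m′ * k + 1) + p * p * k
  split = solve-∀
  expand : ∀ m′ k → let m = suc m′ ; p = 1 + suc m′ * k in
    1 + p * p * (m′ * k + 1) ≡ m * m * m′ * (k * (k * k)) + ((m * m + 2 * m * m′) * (k * k) + ((2 * m + m′) * k + 2))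
  expand = solve-∀
  3m²+1≤k : m * m * 3 + 1 ≤ k
  3m²+1≤k = begin
    m * m * 3 + 1     ≤⟨ +-monoˡ-≤ 1 (*-monoʳ-≤ (m * m) 3≤m′) ⟩
    s + 1             ≡⟨ +-comm s 1 ⟩
    1 + s             ≤⟨ big ⟩
    k                 ∎
  2≤k : 2 ≤ k
  2≤k = ≤-trans (s≤s (s≤s z≤n)) 3m²+1≤k
  low : (2 * m + m′) * k + 2 ≤ (2 * m + 1) * (k * k)
  low = begin
    (2 * m + m′) * k + 2                        ≤⟨ +-monoʳ-≤ ((2 * m + m′) * k) (*-monoʳ-≤ 2 (≤-trans (s≤s z≤n) 2≤k)) ⟩
    (2 * m + m′) * k + 2 * k                    ≤⟨ m≤m+n _ ((m′ + 2) * k) ⟩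
    (2 * m + m′) * k + 2 * k + (m′ + 2) * k     ≡⟨ regroup m′ k ⟩
    (2 * m + 1) * (2 * k)                       ≤⟨ *-monoʳ-≤ (2 * m + 1) (*-monoˡ-≤ k 2≤k) ⟩
    (2 * m + 1) * (k * k)                       ∎
    where
    regroup : ∀ m′ k → (2 * suc m′ + m′) * k + 2 * k + (m′ + 2) * k ≡ (2 * suc m′ + 1) * (2 * k)
    regroup = solve-∀
  -- As a polynomial in `k`, the left side plus 1 is s·k³ plus lower terms, with s = m³ - m². The
  -- lower terms are at most (3m² + 1)k² ≤ k³, and 1 + s ≤ k.
  dominated : p * p * (m′ * k + 1) < k * k * (k * k)
  dominated = begin
    1 + p * p * (m′ * k + 1)                                                                   ≡⟨ expand m′ k ⟩
    s * (k * (k * k)) + ((m * m + 2 * m * m′) * (k * k) + ((2 * m + m′) * k + 2))              ≤⟨ +-monoʳ-≤ (s * (k * (k * k))) (+-monoʳ-≤ ((m * m + 2 * m * m′) * (k * k)) low) ⟩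
    s * (k * (k * k)) + ((m * m + 2 * m * m′) * (k * k) + (2 * m + 1) * (k * k))               ≡⟨ cong (s * (k * (k * k)) +_) (regroup m′ (k * k)) ⟩
    s * (k * (k * k)) + (m * m * 3 + 1) * (k * k)                                              ≤⟨ +-monoʳ-≤ (s * (k * (k * k))) (*-monoˡ-≤ (k * k) 3m²+1≤k) ⟩
    s * (k * (k * k)) + k * (k * k)                                                            ≡⟨ +-comm (s * (k * (k * k))) (k * (k * k)) ⟩
    (1 + s) * (k * (k * k))                                                                    ≤⟨ *-monoˡ-≤ (k * (k * k)) big ⟩
    k * (k * (k * k))                                                                          ≡⟨ *-assoc k k (k * k) ⟨
    k * k * (k * k)                                                                            ∎
    where
    regroup : ∀ m′ u → (suc m′ * suc m′ + 2 * suc m′ * m′) * u + (2 * suc m′ + 1) * u ≡ (suc m′ * suc m′ * 3 + 1) * u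
    regroup = solve-∀

-- Non-residues of small order and consecutive pairs.

QNRNP : (p : ℕ) → .{{NonZero p}} → ℕ → Set
QNRNP p n = QuadraticNonResidue p n × ¬ PrimitiveRoot p n

ConsecutiveQNRNPs : (p : ℕ) → .{{NonZero p}} → ℕ → Set
ConsecutiveQNRNPs p n = 1 ≤ n × n + 1 ≤ p ∸ 1 ×
  QuadraticNonResidue p n × ¬ PrimitiveRoot p n ×
  QuadraticNonResidue p (n + 1) × ¬ PrimitiveRoot p (n + 1)

module _ {p : ℕ} .{{_ : NonZero p}} (pr : Prime p) (2<p : 2 < p) where
  open PrimeModulus pr

  1+[p∸1]≡p : 1 + (p ∸ 1) ≡ p
  1+[p∸1]≡p = suc-pred p

  p∸1<p : p ∸ 1 < p
  p∸1<p = ≤-reflexive 1+[p∸1]≡p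

  2≤p∸1 : 2 ≤ p ∸ 1
  2≤p∸1 = ≤-pred (≤-trans 2<p (≤-reflexive (sym 1+[p∸1]≡p)))

  1%p≡1 : 1 % p ≡ 1
  1%p≡1 = m<n⇒m%n≡m (prime⇒>1 pr)

  -- `p ∸ 1` stands for -1; here (p - 1)² = 1 + (p - 2)p.
  [p∸1]²≡1 : ((p ∸ 1) ^ 2) ≡ 1 [mod p ]
  [p∸1]²≡1 = trans (cong (_% p) (square (p ∸ 1) 2≤p∸1)) (trans (cong (λ q → (1 + pred (p ∸ 1) * q) % p) 1+[p∸1]≡p) ([m+kn]%n≡m%n 1 (pred (p ∸ 1)) p))
    where
    expand : ∀ r → suc r * (suc r * 1) ≡ 1 + r * (2 + r)
    expand = solve-∀
    square : ∀ u → 2 ≤ u → u ^ 2 ≡ 1 + pred u * suc u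
    square (suc u) _ = expand u

  even-power : ∀ q → ((p ∸ 1) ^ (2 * q)) ≡ 1 [mod p ]
  even-power q = trans (cong (_% p) (sym (^-*-assoc (p ∸ 1) 2 q))) (trans (^-cong-mod {n = p} q [p∸1]²≡1) (cong (_% p) (^-zeroˡ q)))

  odd-power : ∀ s → ((p ∸ 1) ^ (1 + 2 * s)) ≡ (p ∸ 1) [mod p ]
  odd-power s = trans (*-cong-mod {n = p} {p ∸ 1} {p ∸ 1} {(p ∸ 1) ^ (2 * s)} {1} refl (even-power s)) (cong (_% p) (*-identityʳ (p ∸ 1)))

  -- Half of Euler's criterion: x² ≡ n would give n^h ≡ x^(p-1) ≡ 1 by Fermat, while 1 ≠ p - 1.
  -- Coprimality holds because n^h is nonzero modulo `p`.
  nonResidue : ∀ {n h} → p ∸ 1 ≡ 2 * h → n ^ h % p ≡ p ∸ 1 → QuadraticNonResidue p n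
  nonResidue {n} {h} p-1≡2h n^h≡-1 = coprime , nonSquare
    where
    0<p∸1 : 0 < p ∸ 1
    0<p∸1 = ≤-trans (s≤s z≤n) 2≤p∸1
    0<h : 0 < h
    0<h = 0<*⇒0<ʳ 2 h (subst (0 <_) p-1≡2h 0<p∸1)
    p∤n : p ∤ n
    p∤n p∣n = <⇒≢ 0<p∸1 (trans (sym (n∣m⇒m%n≡0 _ p (∣⇒∣^ h 0<h p∣n))) n^h≡-1)
    coprime : Coprime n p
    coprime (d∣n , d∣p) with prime⇒irreducible pr d∣p
    ... | inj₁ d≡1 = d≡1
    ... | inj₂ refl = ⊥-elim (p∤n d∣n)
    nonSquare : ¬ ∃ λ x → (x * x) ≡ n [mod p ]
    nonSquare (x , x²≡n) = <⇒≢ 2≤p∸1 (begin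
      1                      ≡⟨ 1%p≡1 ⟨
      1 % p                  ≡⟨ fermat x p∤x ⟨
      x ^ (p ∸ 1) % p        ≡⟨ cong (λ e → x ^ e % p) p-1≡2h ⟩
      x ^ (2 * h) % p        ≡⟨ cong (_% p) (^-*-assoc x 2 h) ⟨
      (x ^ 2) ^ h % p        ≡⟨ cong (λ y → (x * y) ^ h % p) (*-identityʳ x) ⟩
      (x * x) ^ h % p        ≡⟨ ^-cong-mod {n = p} h x²≡n ⟩
      n ^ h % p              ≡⟨ n^h≡-1 ⟩
      p ∸ 1                  ∎)
      where
      open ≡-Reasoning
      p∤x : p ∤ x
      p∤x p∣x = p∤n (m%n≡0⇒n∣m n p (trans (sym x²≡n) (n∣m⇒m%n≡0 _ p (∣m⇒∣m*n x p∣x))))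

  notPrimitive : ∀ {n e} → 0 < e → e < p ∸ 1 → n ^ e % p ≡ 1 → ¬ PrimitiveRoot p n
  notPrimitive {e = e} 0<e e<p-1 n^e≡1 (_ , _ , _ , minimal) = minimal e 0<e e<p-1 (trans n^e≡1 (sym 1%p≡1))

  module _ (s k : ℕ) (0<s : 0 < s) (0<k : 0 < k) (p-1≡ : p ∸ 1 ≡ 2 * (1 + 2 * s) * k) where

    private
      q = 1 + 2 * s

    -1-power⇒QNRNP : ∀ {n} → n ^ k % p ≡ p ∸ 1 → QNRNP p n
    -1-power⇒QNRNP {n} n^k≡-1 =
      nonResidue {h = k * q} (trans p-1≡ (trans (*-assoc 2 q k) (cong (2 *_) (*-comm q k))))
        (trans (cong (_% p) (sym (^-*-assoc n k q))) (trans (^-cong-mod {n = p} q n^k≡-1′) (trans (odd-power s) (m<n⇒m%n≡m p∸1<p)))) ,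
      notPrimitive {e = k * 2} (*-mono-≤ 0<k (s≤s {n = 1} z≤n))
        (subst (k * 2 <_) (sym (trans p-1≡ (rearrange q k))) (*-monoʳ-< k {{>-nonZero 0<k}} (*-monoʳ-< 2 {1} {q} (s≤s (*-mono-≤ (s≤s {n = 1} z≤n) 0<s)))))
        (trans (cong (_% p) (sym (^-*-assoc n k 2))) (trans (^-cong-mod {n = p} 2 n^k≡-1′) (trans [p∸1]²≡1 1%p≡1)))
      where
      n^k≡-1′ : (n ^ k) ≡ (p ∸ 1) [mod p ]
      n^k≡-1′ = trans n^k≡-1 (sym (m<n⇒m%n≡m p∸1<p))
      rearrange : ∀ q k → 2 * q * k ≡ k * (2 * q)
      rearrange = solve-∀

    A H : ℕ → ℕ
    A x = 𝟙 (x ^ k % p ≟ p ∸ 1)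
    H x = 𝟙 (x ^ k % p ≟ 1)

    -- x ↦ t·x/c carries a point of A on a line of slope t ∈ H and intercept c ∈ H to a consecutive pair in A.
    normalise : ∀ t c x → t ^ k % p ≡ 1 → c ^ k % p ≡ 1 → x ^ k % p ≡ p ∸ 1 → (t * x + c) ^ k % p ≡ p ∸ 1 →
                ∃ λ n → n < p × n ^ k % p ≡ p ∸ 1 × (n + 1) ^ k % p ≡ p ∸ 1
    normalise t c x t∈H c∈H x∈A y∈A = n , m%n<n _ p , n∈A , n+1∈A
      where
      open ≡-Reasoning
      -- Since c^k ≡ 1, the power c^(k-1) inverts `c`, and it lies in `H` again.
      c⁻¹ = c ^ (k ∸ 1)
      c*c⁻¹≡1 : (c * c⁻¹) ≡ 1 [mod p ]
      c*c⁻¹≡1 = trans (cong (λ e → c ^ e % p) (m+[n∸m]≡n 0<k)) (trans c∈H (sym 1%p≡1))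
      unit : ∀ {u} → u ^ k % p ≡ 1 → ∀ v → (u * v) ^ k % p ≡ v ^ k % p
      unit {u} u^k≡1 v = trans (cong (_% p) (^-distribʳ-* k u v)) (trans (*-cong-mod {n = p} {u ^ k} {1} {v ^ k} {v ^ k} (trans u^k≡1 (sym 1%p≡1)) refl) (cong (_% p) (*-identityˡ (v ^ k))))
      c⁻¹∈H : c⁻¹ ^ k % p ≡ 1
      c⁻¹∈H = begin
        (c ^ (k ∸ 1)) ^ k % p    ≡⟨ cong (_% p) (trans (^-*-assoc c (k ∸ 1) k) (trans (cong (c ^_) (*-comm (k ∸ 1) k)) (sym (^-*-assoc c k (k ∸ 1))))) ⟩
        (c ^ k) ^ (k ∸ 1) % p    ≡⟨ ^-cong-mod {n = p} (k ∸ 1) (trans c∈H (sym 1%p≡1)) ⟩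
        1 ^ (k ∸ 1) % p          ≡⟨ cong (_% p) (^-zeroˡ (k ∸ 1)) ⟩
        1 % p                    ≡⟨ 1%p≡1 ⟩
        1                        ∎
      n = (c⁻¹ * (t * x)) % p
      n∈A : n ^ k % p ≡ p ∸ 1
      n∈A = trans (^-cong-mod {n = p} k (m%n%n≡m%n _ p)) (trans (unit c⁻¹∈H (t * x)) (trans (unit t∈H x) x∈A))
      n+1≡ : (n + 1) ≡ (c⁻¹ * (t * x + c)) [mod p ]
      n+1≡ = trans (+-cong-mod {n = p} {n} {c⁻¹ * (t * x)} {1} {c * c⁻¹} (m%n%n≡m%n _ p) (sym c*c⁻¹≡1)) (cong (_% p) (factor c⁻¹ (t * x) c))
        where
        factor : ∀ d y c → d * y + c * d ≡ d * (y + c)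
        factor = solve-∀
      n+1∈A : (n + 1) ^ k % p ≡ p ∸ 1
      n+1∈A = trans (^-cong-mod {n = p} k n+1≡) (trans (unit c⁻¹∈H (t * x + c)) y∈A)

    -- If the finite search fails, `normalise` shows that every line with slope and intercept in `H`
    -- is empty. As `A` and `H` have `k` elements, being the fibres of the k-th power map over -1
    -- and 1, `empty-lines` then contradicts `second-moment-gap` at m = 2q, m′ = 1 + 4s.
    consecutive-pair : 1 + 2 * q * (2 * q) * (1 + 4 * s) ≤ k → ∃ λ n → n < p × n ^ k % p ≡ p ∸ 1 × (n + 1) ^ k % p ≡ p ∸ 1
    consecutive-pair big with anyUpTo? (λ n → (n ^ k % p ≟ p ∸ 1) ×-dec ((n + 1) ^ k % p ≟ p ∸ 1)) p
    ... | yes pair = pair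
    ... | no none = ⊥-elim (<⇒≱ gap bound)
      where
      periodic : Periodic p A
      periodic x y x≡y = cong (λ z → 𝟙 (z ≟ p ∸ 1)) (^-cong-mod {n = p} k x≡y)
      open SecondMoment pr A periodic (λ x → 𝟙-idem (x ^ k % p ≟ p ∸ 1))
      0<2q : 0 < 2 * q
      0<2q = s≤s z≤n
      α≡k : ∑ p A ≡ k
      α≡k = fibre-size (2 * q) k p-1≡ 0<2q 0<k p∸1<p (trans (even-power q) 1%p≡1)
      ∑H≡k : ∑ p H ≡ k
      ∑H≡k = fibre-size (2 * q) k p-1≡ 0<2q 0<k (prime⇒>1 pr) (trans (cong (_% p) (^-zeroˡ (2 * q))) 1%p≡1)
      empty : ∀ t c → 0 < H t * H c → incidences t c ≡ 0
      empty t c 0<HtHc = ∑-zero p (λ x _ → term x)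
        where
        term : ∀ x → A x * A (t * x + c) ≡ 0
        term x with A x * A (t * x + c) in eq
        ... | zero = refl
        ... | suc _ = ⊥-elim (none (normalise t c x
          (𝟙>0 (_ ≟ _) (0<*⇒0<ˡ (H t) (H c) 0<HtHc)) (𝟙>0 (_ ≟ _) (0<*⇒0<ʳ (H t) (H c) 0<HtHc))
          (𝟙>0 (_ ≟ _) (0<*⇒0<ˡ (A x) _ 0<AA)) (𝟙>0 (_ ≟ _) (0<*⇒0<ʳ (A x) _ 0<AA))))
          where
          0<AA : 0 < A x * A (t * x + c)
          0<AA = subst (0 <_) (sym eq) (s≤s z≤n)
      bound : k * k * (k * k) + p * p * k ≤ p * p * p
      bound = subst₂ (λ u v → u * u * (v * v) + p * p * v ≤ p * p * p) ∑H≡k α≡k (empty-lines (λ t → 𝟙≤1 (_ ≟ _)) empty (subst (0 <_) (sym α≡k) 0<k))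
      2q≡ : ∀ s → suc (1 + 4 * s) ≡ 2 * (1 + 2 * s)
      2q≡ = solve-∀
      gap : p * p * p < k * k * (k * k) + p * p * k
      gap = subst (λ r → r * r * r < k * k * (k * k) + r * r * k) (trans (cong (λ m → 1 + m * k) (2q≡ s)) (trans (cong suc (sym p-1≡)) 1+[p∸1]≡p))
        (second-moment-gap (1 + 4 * s) k (s≤s (≤-trans (s≤s (s≤s z≤n)) (*-monoʳ-≤ 4 0<s))) (subst (λ m → 1 + m * m * (1 + 4 * s) ≤ k) (sym (2q≡ s)) big))

    -- `consecutive-pair` leaves open n = 0 and n + 1 = p; both are excluded because a multiple of
    -- `p` has k-th power 0, not -1.
    large-k : 1 + 2 * q * (2 * q) * (1 + 4 * s) ≤ k → ∃ (ConsecutiveQNRNPs p)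
    large-k big with consecutive-pair big
    ... | n , n<p , n∈A , n+1∈A with -1-power⇒QNRNP n∈A | -1-power⇒QNRNP n+1∈A
    ... | qnr , npr | qnr′ , npr′ = n , positive n n∈A , ≤-pred (subst (suc (n + 1) ≤_) (sym 1+[p∸1]≡p) (≤∧≢⇒< (subst (_≤ p) (+-comm 1 n) n<p) n+1≢p)) , qnr , npr , qnr′ , npr′
      where
      vanishes : ∀ x → p ∣ x → x ^ k % p ≢ p ∸ 1
      vanishes x p∣x eq = <⇒≢ (≤-trans (s≤s z≤n) 2≤p∸1) (trans (sym (n∣m⇒m%n≡0 _ p (∣⇒∣^ k 0<k p∣x))) eq)
      positive : ∀ n → n ^ k % p ≡ p ∸ 1 → 1 ≤ n
      positive zero eq = ⊥-elim (vanishes 0 (p ∣0) eq)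
      positive (suc n) _ = s≤s z≤n
      n+1≢p : n + 1 ≢ p
      n+1≢p eq = vanishes (n + 1) (∣-reflexive (sym eq)) n+1∈A

-- Euler's totient and the odd prime divisors.

length-filter-applyUpTo : ∀ {P : ℕ → Set} (P? : ∀ i → Dec (P i)) (f : ℕ → ℕ) n →
                         length (filter P? (applyUpTo f n)) ≡ ∑[ i < n ] 𝟙 (P? (f i))
length-filter-applyUpTo P? f zero = refl
length-filter-applyUpTo P? f (suc n) = trans first (sym (∑-splitˡ n (λ i → 𝟙 (P? (f i)))))
  where
  first : length (filter P? (f 0 ∷ applyUpTo (f ∘ suc) n)) ≡ 𝟙 (P? (f 0)) + ∑[ i < n ] 𝟙 (P? (f (suc i)))
  first with P? (f 0)
  ... | yes _ = cong suc (length-filter-applyUpTo P? (f ∘ suc) n)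
  ... | no _ = length-filter-applyUpTo P? (f ∘ suc) n

φ≡∑ : ∀ n → φ n ≡ ∑[ i < n ] 𝟙 (gcd (suc i) n ≟ 1)
φ≡∑ n = trans (cong (length ∘ filter (λ k → gcd k n ≟ 1)) (map-applyUpTo id suc n)) (length-filter-applyUpTo (λ k → gcd k n ≟ 1) suc n)

even⊎odd : ∀ n → ∃ λ a → n ≡ 2 * a ⊎ n ≡ 1 + 2 * a
even⊎odd zero = 0 , inj₁ refl
even⊎odd (suc n) with even⊎odd n
... | a , inj₁ refl = a , inj₂ refl
... | a , inj₂ refl = suc a , inj₁ (cong suc (sym (+-suc a (a + 0))))

oddPrime : ∀ {q} → Prime q → 2 < q → ∃ λ a → q ≡ 1 + 2 * a
oddPrime {q} pr 2<q with even⊎odd q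
... | a , inj₂ eq = a , eq
... | a , inj₁ refl with prime⇒irreducible pr (m∣m*n {2} a)
... | inj₂ 2≡q = ⊥-elim (<⇒≢ 2<q 2≡q)

primeDivisor : ∀ n → n ≢ 0 → n ≢ 1 → ∃ λ q → Prime q × q ∣ n
primeDivisor n n≢0 n≢1 with factorise n {{≢-nonZero n≢0}}
... | record { factors = [] ; isFactorisation = n≡1 } = ⊥-elim (n≢1 n≡1)
... | record { factors = q ∷ qs ; isFactorisation = n≡ ; factorsPrime = pr ∷ _ } = q , pr , subst (q ∣_) (sym n≡) (m∣m*n _)

module Sieve (M : ℕ) (0<M : 0 < M) where

  OddPrimeDivisor : ℕ → Set
  OddPrimeDivisor d = 2 < d × Prime d × d ∣ M

  oddPrimeDivisor? : ∀ d → Dec (OddPrimeDivisor d)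
  oddPrimeDivisor? d = (2 <? d) ×-dec (prime? d ×-dec (d ∣? M))

  oddPrimeDivisors : List ℕ
  oddPrimeDivisors = filter oddPrimeDivisor? (upTo (suc M))

  sound : All OddPrimeDivisor oddPrimeDivisors
  sound = all-filter oddPrimeDivisor? (upTo (suc M))

  increasing : AllPairs _<_ oddPrimeDivisors
  increasing = AllPairs.filter⁺ oddPrimeDivisor? (AllPairs.applyUpTo⁺₁ id (suc M) (λ i<j _ → i<j))

  oddMultiples : ℕ → ℕ
  oddMultiples d = ∑[ i < M ] 𝟙 (d ∣? suc (2 * i))

  -- Two of `d` consecutive odd numbers differ by 2(j - i) with 0 < j - i < d, so at most one is a
  -- multiple of the odd prime `d`. The `M` odd numbers below 2M split into M/d such blocks.
  oddMultiples-≤ : ∀ {d} → OddPrimeDivisor d → oddMultiples d * d ≤ M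
  oddMultiples-≤ {d} (2<d , pr , divides u refl) = *-monoˡ-≤ d (blocks u)
    where
    2*-suc : ∀ e i → 2 * e + suc (2 * i) ≡ suc (2 * (e + i))
    2*-suc = solve-∀
    cancel : ∀ e i → d ∣ suc (2 * (e + i)) → d ∣ 2 * e → d ∣ suc (2 * i)
    cancel e i d∣ = ∣m+n∣m⇒∣n (subst (d ∣_) (sym (2*-suc e i)) d∣)
    block : ∑[ i < d ] 𝟙 (d ∣? suc (2 * i)) ≤ 1
    block = ∑-unique≤1 d (λ i → d ∣? suc (2 * i)) λ i j j<d i<j d∣i d∣j →
      distinct i j j<d i<j (∣m+n∣m⇒∣n (subst (d ∣_) (trans (cong (λ l → suc (2 * l)) (sym (m∸n+n≡m (<⇒≤ i<j)))) (trans (sym (2*-suc (j ∸ i) i)) (+-comm (2 * (j ∸ i)) _))) d∣j) d∣i)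
      where
      distinct : ∀ i j → j < d → i < j → ¬ d ∣ 2 * (j ∸ i)
      distinct i j j<d i<j d∣ with euclidsLemma 2 (j ∸ i) pr d∣
      ... | inj₁ d∣2 = >⇒∤ 2<d d∣2
      ... | inj₂ d∣j-i = >⇒∤ {{>-nonZero (m<n⇒0<n∸m i<j)}} (≤-<-trans (m∸n≤m j i) j<d) d∣j-i
    blocks : ∀ u → ∑[ i < u * d ] 𝟙 (d ∣? suc (2 * i)) ≤ u
    blocks zero = z≤n
    blocks (suc u) = begin
      ∑[ i < d + u * d ] 𝟙 (d ∣? suc (2 * i))
        ≡⟨ ∑-split d (u * d) _ ⟩
      ∑[ i < d ] 𝟙 (d ∣? suc (2 * i)) + ∑[ i < u * d ] 𝟙 (d ∣? suc (2 * (d + i)))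
        ≤⟨ +-mono-≤ block (∑-mono (u * d) (λ i _ → 𝟙-mono (d ∣? _) (d ∣? _) (λ d∣ → cancel d i d∣ (n∣m*n 2)))) ⟩
      1 + ∑[ i < u * d ] 𝟙 (d ∣? suc (2 * i))
        ≤⟨ s≤s (blocks u) ⟩
      suc u ∎
      where open ≤-Reasoning

  hits : List ℕ → ℕ → ℕ
  hits ds i = sum (map (λ d → 𝟙 (d ∣? suc (2 * i))) ds)

  ∑-hits : ∀ ds → ∑ M (hits ds) ≡ sum (map oddMultiples ds)
  ∑-hits [] = ∑-zero M (λ _ _ → refl)
  ∑-hits (d ∷ ds) = trans (∑-distrib-+ M _ (hits ds)) (cong (oddMultiples d +_) (∑-hits ds))

  hits-∈ : ∀ {d ds} i → d ∈ ds → d ∣ suc (2 * i) → 1 ≤ hits ds i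
  hits-∈ {d} i (here refl) d∣ = ≤-trans (≤-reflexive (sym (𝟙-yes (d ∣? _) d∣))) (m≤m+n _ _)
  hits-∈ i (there d∈) d∣ = ≤-trans (hits-∈ i d∈ d∣) (m≤n+m _ _)

  -- A prime factor of the gcd divides an odd number, so it is odd; hence it divides `M` and occurs
  -- in the list.
  coprime-or-hit : ∀ i → 1 ≤ 𝟙 (gcd (suc (2 * i)) (2 * M) ≟ 1) + hits oddPrimeDivisors i
  coprime-or-hit i with gcd (suc (2 * i)) (2 * M) ≟ 1
  ... | yes _ = s≤s z≤n
  ... | no g≢1 with primeDivisor g (gcd[m,n]≢0 (suc (2 * i)) (2 * M) (inj₁ λ ())) g≢1
    where g = gcd (suc (2 * i)) (2 * M)
  ... | q , pr , q∣g = hits-∈ i (∈-filter⁺ oddPrimeDivisor? (∈-upTo⁺ (s≤s (∣⇒≤ {{>-nonZero 0<M}} q∣M))) (2<q , pr , q∣M)) q∣odd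
    where
    q∣odd : q ∣ suc (2 * i)
    q∣odd = ∣-trans q∣g (gcd[m,n]∣m (suc (2 * i)) (2 * M))
    2<q : 2 < q
    2<q = ≤∧≢⇒< (prime⇒>1 pr) (λ { refl → <⇒≢ (s≤s {n = 1} (s≤s z≤n)) (sym (∣1⇒≡1 (∣m+n∣m⇒∣n (subst (2 ∣_) (+-comm 1 (2 * i)) q∣odd) (m∣m*n i)))) })
    q∣M : q ∣ M
    q∣M with euclidsLemma 2 M pr (∣-trans q∣g (gcd[m,n]∣n (suc (2 * i)) (2 * M)))
    ... | inj₁ q∣2 = ⊥-elim (>⇒∤ 2<q q∣2)
    ... | inj₂ q∣M = q∣M

  -- Union bound over the `M` odd numbers. Those coprime to 2M are among the numbers counted by
  -- φ(2M), where 2i + 1 has index 2i.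
  sieve-bound : M ≤ φ (2 * M) + sum (map oddMultiples oddPrimeDivisors)
  sieve-bound = begin
    M                                                                                    ≡⟨ trans (∑-const M 1) (*-identityʳ M) ⟨
    ∑[ i < M ] 1                                                                         ≤⟨ ∑-mono M (λ i _ → coprime-or-hit i) ⟩
    ∑[ i < M ] (𝟙 (gcd (suc (2 * i)) (2 * M) ≟ 1) + hits oddPrimeDivisors i)             ≡⟨ ∑-distrib-+ M _ _ ⟩
    ∑[ i < M ] 𝟙 (gcd (suc (2 * i)) (2 * M) ≟ 1) + ∑ M (hits oddPrimeDivisors)           ≤⟨ +-mono-≤ odd-part (≤-reflexive (∑-hits oddPrimeDivisors)) ⟩
    φ (2 * M) + sum (map oddMultiples oddPrimeDivisors)                                  ∎
    where
    open ≤-Reasoning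
    odd-part : ∑[ i < M ] 𝟙 (gcd (suc (2 * i)) (2 * M) ≟ 1) ≤ φ (2 * M)
    odd-part = ≤-trans
      (∑-injective M (2 * M) (2 *_) (λ j → 𝟙 (gcd (suc j) (2 * M) ≟ 1)) (λ i i<M → *-monoʳ-< 2 i<M) (λ i j _ i<j eq → <⇒≢ i<j (*-cancelˡ-≡ i j 2 eq)))
      (≤-reflexive (sym (φ≡∑ (2 * M))))

  -- At most M/2 odd numbers are coprime to 2M, so at least M/2 are hit. With `oddMultiples-≤` this
  -- says that the reciprocals of the odd prime divisors add up to at least 1/2.
  few-coprimes⇒many-multiples : 4 * φ (2 * M) ≤ 2 * M → M ≤ 2 * sum (map oddMultiples oddPrimeDivisors)
  few-coprimes⇒many-multiples 4φ≤2M = +-cancelˡ-≤ M M _ (begin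
    M + M                        ≡⟨ cong (M +_) (+-identityʳ M) ⟨
    2 * M                        ≤⟨ *-monoʳ-≤ 2 sieve-bound ⟩
    2 * (φ (2 * M) + S)          ≡⟨ *-distribˡ-+ 2 (φ (2 * M)) S ⟩
    2 * φ (2 * M) + 2 * S        ≤⟨ +-monoˡ-≤ (2 * S) (*-cancelˡ-≤ {2 * φ (2 * M)} {M} 2 (subst (_≤ 2 * M) (*-assoc 2 2 (φ (2 * M))) 4φ≤2M)) ⟩
    M + 2 * S                    ∎)
    where
    open ≤-Reasoning
    S = sum (map oddMultiples oddPrimeDivisors)

-- 1/5 + 1/7 + 1/9 < 1/2
three-small : ∀ {M} a b c → 0 < M → a * 5 ≤ M → b * 7 ≤ M → c * 9 ≤ M → ¬ M ≤ 2 * (a + (b + (c + 0)))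
three-small {M} a b c 0<M a≤ b≤ c≤ M≤ = <⇒≱ (*-monoˡ-< M {{>-nonZero 0<M}} {286} {315} (toWitness {a? = 286 <? 315} _)) (begin
  -- 315 = 5·7·9, and the weights below are 2·315 divided by 5, 7 and 9.
  315 * M                                              ≤⟨ *-monoʳ-≤ 315 M≤ ⟩
  315 * (2 * (a + (b + (c + 0))))                      ≡⟨ regroup a b c ⟩
  126 * (a * 5) + 90 * (b * 7) + 70 * (c * 9)          ≤⟨ +-mono-≤ (+-mono-≤ (*-monoʳ-≤ 126 a≤) (*-monoʳ-≤ 90 b≤)) (*-monoʳ-≤ 70 c≤) ⟩
  126 * M + 90 * M + 70 * M                            ≡⟨ total M ⟩
  286 * M                                              ∎)
  where
  open ≤-Reasoning
  regroup : ∀ a b c → 315 * (2 * (a + (b + (c + 0)))) ≡ 126 * (a * 5) + 90 * (b * 7) + 70 * (c * 9)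
  regroup = solve-∀
  total : ∀ M → 126 * M + 90 * M + 70 * M ≡ 286 * M
  total = solve-∀

-- 1/7 + 1/9 + 1/11 + 1/13 < 1/2
four-small : ∀ {M} a b c d → 0 < M → a * 7 ≤ M → b * 9 ≤ M → c * 11 ≤ M → d * 13 ≤ M → ¬ M ≤ 2 * (a + (b + (c + (d + 0))))
four-small {M} a b c d 0<M a≤ b≤ c≤ d≤ M≤ = <⇒≱ (*-monoˡ-< M {{>-nonZero 0<M}} {7600} {9009} (toWitness {a? = 7600 <? 9009} _)) (begin
  9009 * M                                                                 ≤⟨ *-monoʳ-≤ 9009 M≤ ⟩
  9009 * (2 * (a + (b + (c + (d + 0)))))                                   ≡⟨ regroup a b c d ⟩
  2574 * (a * 7) + 2002 * (b * 9) + 1638 * (c * 11) + 1386 * (d * 13)      ≤⟨ +-mono-≤ (+-mono-≤ (+-mono-≤ (*-monoʳ-≤ 2574 a≤) (*-monoʳ-≤ 2002 b≤)) (*-monoʳ-≤ 1638 c≤)) (*-monoʳ-≤ 1386 d≤) ⟩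
  2574 * M + 2002 * M + 1638 * M + 1386 * M                                ≡⟨ total M ⟩
  7600 * M                                                                 ∎)
  where
  open ≤-Reasoning
  regroup : ∀ a b c d → 9009 * (2 * (a + (b + (c + (d + 0))))) ≡ 2574 * (a * 7) + 2002 * (b * 9) + 1638 * (c * 11) + 1386 * (d * 13)
  regroup = solve-∀
  total : ∀ M → 2574 * M + 2002 * M + 1638 * M + 1386 * M ≡ 7600 * M
  total = solve-∀

-- Small primes congruent to 1 modulo 6.

Small : ℕ → Set
Small k = k ∈ 35 ∷ 55 ∷ 70 ∷ 105 ∷ 110 ∷ 165 ∷ 175 ∷ [] ⊎ Composite (1 + 6 * k) ⊎ 6 * k < 4 * φ (6 * k)

small? : ∀ k → Dec (Small k)
small? k = (k ∈? _) ⊎-dec (composite? (1 + 6 * k) ⊎-dec (6 * k <? 4 * φ (6 * k)))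

-- Here p = 1 + 6k with k = j + 1 ≤ 180. Evaluation of the decision procedure shows that outside the
-- seven listed `k` either `p` is composite or the totient hypothesis fails.
small-check : ∀ {j} → j < 180 → Small (suc j)
small-check = toWitness {a? = allUpTo? (λ j → small? (suc j)) 180} _

-- For h = (p - 1)/2 the first power meets Euler's criterion, and the exponent `e` bounds the order
-- below p - 1; both are checked by computation.
NonResidueCertificate : (p : ℕ) → .{{NonZero p}} → ℕ → ℕ → ℕ → Set
NonResidueCertificate p h n e = n ^ h % p ≡ p ∸ 1 × 0 < e × e < p ∸ 1 × n ^ e % p ≡ 1

PairCertificate : (p : ℕ) → .{{NonZero p}} → ℕ → ℕ → ℕ → ℕ → Set
PairCertificate p h n e e′ = (2 < p × p ∸ 1 ≡ 2 * h × 1 ≤ n × n + 1 ≤ p ∸ 1) ×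
  NonResidueCertificate p h n e × NonResidueCertificate p h (n + 1) e′

pairCertificate? : ∀ p → .{{_ : NonZero p}} → ∀ h n e e′ → Dec (PairCertificate p h n e e′)
pairCertificate? p h n e e′ =
  ((2 <? p) ×-dec ((p ∸ 1 ≟ 2 * h) ×-dec ((1 ≤? n) ×-dec (n + 1 ≤? p ∸ 1)))) ×-dec (certificate? n e ×-dec certificate? (n + 1) e′)
  where
  certificate? : ∀ n e → Dec (NonResidueCertificate p h n e)
  certificate? n e = (n ^ h % p ≟ p ∸ 1) ×-dec ((0 <? e) ×-dec ((e <? p ∸ 1) ×-dec (n ^ e % p ≟ 1)))

certified : ∀ {p} .{{_ : NonZero p}} → Prime p → ∀ h n e e′ → {True (pairCertificate? p h n e e′)} → ∃ (ConsecutiveQNRNPs p)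
certified {p} pr h n e e′ {ok} with toWitness {a? = pairCertificate? p h n e e′} ok
... | (2<p , p-1≡2h , 1≤n , n≤) , (n^h , 0<e , e< , n^e) , (n′^h , 0<e′ , e′< , n′^e) =
  n , 1≤n , n≤ , nonResidue pr 2<p {h = h} p-1≡2h n^h , notPrimitive pr 2<p 0<e e< n^e ,
  nonResidue pr 2<p {h = h} p-1≡2h n′^h , notPrimitive pr 2<p 0<e′ e′< n′^e

-- The witnesses are (p - 1)/2, `n`, and exponents that send `n` and n + 1 to 1.
exceptional : ∀ {k} → k ∈ 35 ∷ 55 ∷ 70 ∷ 105 ∷ 110 ∷ 165 ∷ 175 ∷ [] → Prime (1 + 6 * k) → ∃ (ConsecutiveQNRNPs (1 + 6 * k))
exceptional (here refl) pr = certified {211} pr 105 26 42 70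
exceptional (there (here refl)) pr = certified {331} pr 165 7 110 110
exceptional (there (there (here refl))) pr = certified {421} pr 210 61 140 140
exceptional (there (there (there (here refl)))) pr = certified {631} pr 315 27 210 210
exceptional (there (there (there (there (here refl))))) pr = certified {661} pr 330 7 220 220
exceptional (there (there (there (there (there (here refl)))))) pr = certified {991} pr 495 14 330 90
exceptional (there (there (there (there (there (there (here refl))))))) pr = certified {1051} pr 525 2 350 210

small-k : ∀ {p} .{{_ : NonZero p}} → Prime p → ∀ k → Small k → p ≡ 1 + 6 * k →
          4 * φ (6 * k) ≤ 6 * k → ∃ (ConsecutiveQNRNPs p)
small-k pr k (inj₁ k∈) refl 4φ≤ = exceptional k∈ pr
small-k pr k (inj₂ (inj₁ c)) refl 4φ≤ = ⊥-elim (composite⇒¬prime c pr)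
small-k pr k (inj₂ (inj₂ 4φ>)) refl 4φ≤ = ⊥-elim (<⇒≱ 4φ> 4φ≤)

-- Choice of the odd divisor q.

next-odd : ∀ {n} a b → n ≡ 1 + 2 * a → 1 + 2 * b ≤ n → n ≢ 1 + 2 * b → 3 + 2 * b ≤ n
next-odd a b refl ≤n ≢n = subst (_≤ 1 + 2 * a) (cong suc (*-suc 2 b))
  (s≤s (*-monoʳ-≤ 2 {suc b} {a} (≤∧≢⇒< (*-cancelˡ-≤ 2 (≤-pred ≤n)) (λ { refl → ≢n refl }))))

-- Writing n = rd for the first prime `d`, each later prime divides rd but not the smaller number
-- `d`, so it divides `r` and induction applies.
product-primes-∣ : ∀ {ds n} → All Prime ds → AllPairs _<_ ds → All (_∣ n) ds → product ds ∣ n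
product-primes-∣ [] [] [] = 1∣ _
product-primes-∣ {d ∷ ds} (pr ∷ prs) (d< ∷ <s) (divides r refl ∷ ∣n) =
  subst (_∣ r * d) (*-comm (product ds) d) (*-monoˡ-∣ d (product-primes-∣ prs <s (descend prs d< ∣n)))
  where
  descend : ∀ {es} → All Prime es → All (d <_) es → All (_∣ r * d) es → All (_∣ r) es
  descend [] [] [] = []
  descend (pe ∷ pes) (d<e ∷ d<es) (e∣ ∷ es∣) with euclidsLemma r d pe e∣
  ... | inj₁ e∣r = e∣r ∷ descend pes d<es es∣
  ... | inj₂ e∣d = ⊥-elim (>⇒∤ {{prime⇒nonZero pr}} d<e e∣d)

module Conclusion {p : ℕ} .{{_ : NonZero p}} (pr : Prime p) (2<p : 2 < p)
  (M : ℕ) (0<M : 0 < M) (p-1≡2M : p ∸ 1 ≡ 2 * M) (4φ≤2M : 4 * φ (2 * M) ≤ 2 * M) where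
  open Sieve M 0<M

  -- This takes q = x. The primes `ys` differ from `x`, so their product divides k = M/x and bounds
  -- it from below, which meets the threshold of `large-k`.
  large-cofactor : ∀ {x ys} s k → x ≡ 1 + 2 * s → 0 < s → M ≡ k * x →
    Prime x → All (x <_) ys → All OddPrimeDivisor ys → AllPairs _<_ ys →
    1 + 2 * x * (2 * x) * (1 + 4 * s) ≤ product ys → ∃ (ConsecutiveQNRNPs p)
  large-cofactor {x} {ys} s k refl 0<s refl prx x<ys oddys <ys big =
    large-k pr 2<p s k 0<s 0<k (trans p-1≡2M (rearrange k x)) (≤-trans big (∣⇒≤ {{>-nonZero 0<k}} ys∣k))
    where
    rearrange : ∀ k x → 2 * (k * x) ≡ 2 * x * k
    rearrange = solve-∀
    0<k : 0 < k
    0<k = 0<*⇒0<ˡ k x 0<M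
    xys∣M : product (x ∷ ys) ∣ k * x
    xys∣M = product-primes-∣ (prx ∷ All.map (λ (_ , pry , _) → pry) oddys) (x<ys ∷ <ys)
      (divides k refl ∷ All.map (λ (_ , _ , y∣M) → y∣M) oddys)
    ys∣k : product ys ∣ k
    ys∣k = *-cancelˡ-∣ x (subst (product (x ∷ ys) ∣_) (*-comm k x) xys∣M)

  at-most : ∀ {d} b → OddPrimeDivisor d → b ≤ d → oddMultiples d * b ≤ M
  at-most {d} b odd b≤d = ≤-trans (*-monoʳ-≤ (oddMultiples d) b≤d) (oddMultiples-≤ odd)

  from-divisors : ∀ ds → All OddPrimeDivisor ds → AllPairs _<_ ds → M ≤ 2 * sum (map oddMultiples ds) → ∃ (ConsecutiveQNRNPs p)
  from-divisors [] _ _ M≤0 = ⊥-elim (<⇒≱ 0<M M≤0)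
  from-divisors (x ∷ ys) (oddx@(2<x , prx , divides k M≡kx) ∷ oddys) (x<ys ∷ <ys) M≤ with x ≟ 3
  ... | yes refl = divisible-by-3
    where
    M≡ : 2 * M ≡ 6 * k
    M≡ = trans (cong (2 *_) M≡kx) (rearrange k)
      where
      rearrange : ∀ k → 2 * (k * 3) ≡ 6 * k
      rearrange = solve-∀
    0<k : 0 < k
    0<k = 0<*⇒0<ˡ k 3 (subst (0 <_) M≡kx 0<M)
    divisible-by-3 : ∃ (ConsecutiveQNRNPs p)
    -- 181 = 1 + 6²·5 is the threshold of `large-k` for q = 3.
    divisible-by-3 with k <? 181
    ... | no k≮181 = large-k pr 2<p 1 k (s≤s z≤n) 0<k (trans p-1≡2M M≡) (≮⇒≥ k≮181)
    ... | yes k<181 = small-k pr k (subst Small 1+[k∸1]≡k (small-check (≤-pred (subst (_< 181) (sym 1+[k∸1]≡k) k<181))))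
        (trans (sym (suc-pred p)) (cong suc (trans p-1≡2M M≡))) (subst (λ n → 4 * φ n ≤ n) M≡ 4φ≤2M)
      where
      1+[k∸1]≡k : suc (k ∸ 1) ≡ k
      1+[k∸1]≡k = m+[n∸m]≡n 0<k
  ... | no x≢3 with oddPrime prx 2<x
  ... | a , x≡1+2a = prime-to-3 ys oddys x<ys <ys M≤
    where
    5≤x : 5 ≤ x
    5≤x = next-odd a 1 x≡1+2a 2<x x≢3
    0<a : 0 < a
    0<a = 0<*⇒0<ʳ 2 a (≤-trans (s≤s z≤n) (≤-pred (subst (5 ≤_) x≡1+2a 5≤x)))
    gap : ∀ {y z} b → OddPrimeDivisor z → 1 + 2 * b ≤ y → y < z → 3 + 2 * b ≤ z
    gap b (2<z , prz , _) b≤y y<z with oddPrime prz 2<z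
    ... | c , z≡ = next-odd c b z≡ (<⇒≤ (≤-<-trans b≤y y<z)) (λ { refl → <⇒≱ y<z b≤y })
    -- Up to three primes the reciprocals add up to less than 1/2, absent primes entering with count
    -- 0; so do those of four primes from 7 on. Four primes starting with 5, or at least five
    -- primes, go to `large-cofactor`.
    prime-to-3 : ∀ ys → All OddPrimeDivisor ys → All (x <_) ys → AllPairs _<_ ys →
                 M ≤ 2 * (oddMultiples x + sum (map oddMultiples ys)) → ∃ (ConsecutiveQNRNPs p)
    prime-to-3 [] _ _ _ M≤ = ⊥-elim (three-small (oddMultiples x) 0 0 0<M (at-most 5 oddx 5≤x) z≤n z≤n M≤)
    prime-to-3 (y ∷ []) (oddy ∷ []) (x<y ∷ []) _ M≤ =
      ⊥-elim (three-small (oddMultiples x) (oddMultiples y) 0 0<M (at-most 5 oddx 5≤x) (at-most 7 oddy (gap 2 oddy 5≤x x<y)) z≤n M≤)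
    prime-to-3 (y ∷ z ∷ []) (oddy ∷ oddz ∷ []) (x<y ∷ _) ((y<z ∷ _) ∷ _) M≤ =
      ⊥-elim (three-small (oddMultiples x) (oddMultiples y) (oddMultiples z) 0<M (at-most 5 oddx 5≤x) (at-most 7 oddy 7≤y) (at-most 9 oddz (gap 3 oddz 7≤y y<z)) M≤)
      where
      7≤y : 7 ≤ y
      7≤y = gap 2 oddy 5≤x x<y
    prime-to-3 ys@(y ∷ z ∷ w ∷ []) oddys@(oddy ∷ oddz@(2<z , prz , _) ∷ oddw ∷ []) x<ys@(x<y ∷ _) <ys@((y<z ∷ _) ∷ (z<w ∷ _) ∷ _) M≤ with x ≟ 5
    -- For q = 5 the threshold is 901 = 1 + 10²·9. The other primes have product at least 7·11·13 =
    -- 1001, since the second of them is at least 9 and 9 is composite.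
    ... | yes refl = large-cofactor 2 k refl (s≤s z≤n) M≡kx prx x<ys oddys <ys
          (≤-trans (toWitness {a? = 901 ≤? 1001} _) (*-mono-≤ 7≤y (*-mono-≤ 11≤z (*-mono-≤ 13≤w (≤-refl {1})))))
      where
      7≤y : 7 ≤ y
      7≤y = gap 2 oddy 5≤x x<y
      z≢9 : z ≢ 9
      z≢9 refl = composite⇒¬prime (composite-∣ (composite-≢ 3 (λ ()) (divides 3 refl)) ∣-refl) prz
      11≤z : 11 ≤ z
      11≤z with oddPrime prz 2<z
      ... | c , z≡ = next-odd c 4 z≡ (gap 3 oddz 7≤y y<z) z≢9
      13≤w : 13 ≤ w
      13≤w = gap 5 oddw 11≤z z<w
    ... | no x≢5 = ⊥-elim (four-small (oddMultiples x) (oddMultiples y) (oddMultiples z) (oddMultiples w) 0<M (at-most 7 oddx 7≤x) (at-most 9 oddy 9≤y) (at-most 11 oddz 11≤z) (at-most 13 oddw (gap 5 oddw 11≤z z<w)) M≤)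
      where
      7≤x : 7 ≤ x
      7≤x = next-odd a 2 x≡1+2a 5≤x x≢5
      9≤y : 9 ≤ y
      9≤y = gap 3 oddy 7≤x x<y
      11≤z : 11 ≤ z
      11≤z = gap 4 oddz 9≤y y<z
    prime-to-3 (y ∷ z ∷ w ∷ v ∷ _) (oddy ∷ oddz ∷ oddw ∷ oddv ∷ _) (x<y ∷ x<z ∷ x<w ∷ x<v ∷ _)
      ((y<z ∷ y<w ∷ y<v ∷ _) ∷ (z<w ∷ z<v ∷ _) ∷ (w<v ∷ _) ∷ _) _ =
      -- The first four primes after `x` suffice: the threshold 8x³ - 4x² + 1 is at most 8x³, while
      -- `y`, `z`, `w` exceed `x` and v ≥ 8.
      large-cofactor {ys = y ∷ z ∷ w ∷ v ∷ []} a k x≡1+2a 0<a M≡kx prx (x<y ∷ x<z ∷ x<w ∷ x<v ∷ []) (oddy ∷ oddz ∷ oddw ∷ oddv ∷ [])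
        ((y<z ∷ y<w ∷ y<v ∷ []) ∷ (z<w ∷ z<v ∷ []) ∷ (w<v ∷ []) ∷ [] ∷ []) (begin
        1 + 2 * x * (2 * x) * (1 + 4 * a)                      ≤⟨ +-monoˡ-≤ _ 1≤4x² ⟩
        2 * x * (2 * x) + 2 * x * (2 * x) * (1 + 4 * a)        ≡⟨ cong (λ x → 2 * x * (2 * x) + 2 * x * (2 * x) * (1 + 4 * a)) x≡1+2a ⟩
        _                                                      ≡⟨ cube a ⟩
        _                                                      ≡⟨ cong (λ x → x * (x * (x * (8 * 1)))) x≡1+2a ⟨
        x * (x * (x * (8 * 1)))                                ≤⟨ *-mono-≤ (<⇒≤ x<y) (*-mono-≤ (<⇒≤ x<z) (*-mono-≤ (<⇒≤ x<w) (*-monoˡ-≤ 1 8≤v))) ⟩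
        y * (z * (w * (v * 1)))                                ∎)
      where
      open ≤-Reasoning
      1≤4x² : 1 ≤ 2 * x * (2 * x)
      1≤4x² = *-mono-≤ 1≤2x 1≤2x
        where
        1≤2x : 1 ≤ 2 * x
        1≤2x = ≤-trans (≤-trans (s≤s z≤n) 5≤x) (m≤m+n x (x + 0))
      8≤v : 8 ≤ v
      8≤v = ≤-trans (s≤s (≤-trans (s≤s (≤-trans (s≤s 5≤x) x<y)) y<z)) (<-trans z<w w<v)
      cube : ∀ a → let x = 1 + 2 * a in 2 * x * (2 * x) + 2 * x * (2 * x) * (1 + 4 * a) ≡ x * (x * (x * (8 * 1)))
      cube = solve-∀

  conclusion : ∃ (ConsecutiveQNRNPs p)
  conclusion = from-divisors oddPrimeDivisors sound increasing (few-coprimes⇒many-multiples 4φ≤2M)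

theorem1 : (p : ℕ) → .{{_ : NonZero p}} → Prime p → 4 * φ (p ∸ 1) ≤ p ∸ 1 →
    ∃ λ n → 1 ≤ n × n + 1 ≤ p ∸ 1 ×
    QuadraticNonResidue p n × ¬ PrimitiveRoot p n ×
    QuadraticNonResidue p (n + 1) × ¬ PrimitiveRoot p (n + 1)
theorem1 p pr 4φ≤ with p ≟ 2
-- As φ(1) = 1, the hypothesis would read 4 ≤ 1.
... | yes refl = ⊥-elim (<⇒≱ (s≤s (s≤s z≤n)) 4φ≤)
... | no p≢2 with oddPrime pr (≤∧≢⇒< (prime⇒>1 pr) (p≢2 ∘ sym))
... | M , refl = Conclusion.conclusion pr 2<p M 0<M refl 4φ≤
  where
  2<p = ≤∧≢⇒< (prime⇒>1 pr) (p≢2 ∘ sym)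
  0<M : 0 < M
  0<M = 0<*⇒0<ʳ 2 M (≤-trans (s≤s z≤n) (≤-pred 2<p))
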